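{- Let $n\ge 2$. The canonical oriented adjoint $\tilde{\mathbf{O}}_n$ of the cross-polytope $\mathbf{O}_n$ is, up to isomorphism, the unique realizable oriented adjoint of $\mathbf{O}_n$ with respect to $\mathcal D_1=\{Y_i\}_{i\in[n]}\cup\{X_{A'}\}_{A\subseteq[n]}$.
   Context: Signed sets are written $X=(X^+,X^-)$. $[n]=\{1,\dots,n\}$, $[n]'=\{1',\dots,n'\}$ is a disjoint copy of $[n]$, and $A'=\{i':i\in A\}$ for $A\subseteq[n]$. $\mathbf{O}_n$ is the oriented matroid on $[n]\cup[n]'$ of affine dependencies of the points $e_1,\dots,e_n,-e_1,\dots,-e_n$ of $\mathbb{R}^n$ ($i$ corresponds to $e_i$, $i'$ to $-e_i$). It has rank $n+1$, and its signed cocircuits are $\pm X_{A'}$ with $X_{A'}=(([n]\setminus A)\cup A',\emptyset)$ for $A\subseteq[n]$, and $\pm Y_i$ with $Y_i=(\{i\},\{i'\})$ for $i\in[n]$. An (oriented) adjoint of $\mathbf{O}_n$ with respect to $\mathcal D_1$ is an oriented matroid $\tilde{\mathcal M}$ on the ground set $\mathcal D_1$, of rank $n+1$, whose signed cocircuits include, for every $i\in[n]$, the signed sets $\tilde X[i]=(\{X_{A'}\}_{A\subseteq[n]\setminus i}\cup\{Y_i\},\emptyset)$ and $\tilde X[i']=(\{X_{A'\cup i'}\}_{A\subseteq[n]\setminus i},\{Y_i\})$. The canonical adjoint $\tilde{\mathbf{O}}_n$ is the oriented matroid on $\mathcal D_1$ obtained from the oriented matroid of linear dependencies over $\mathbb{R}$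 of the vectors $\{(e_i,0)\}_{i\in[n]}\cup\{(v_A,1)\}_{A\subseteq[n]}\subseteq\mathbb{R}^{n+1}$ via the bijection $(e_i,0)\mapsto Y_i$, $(v_A,1)\mapsto X_{A'}$, where $v_A\in\mathbb{R}^n$ has $v_A(i)=-1$ for $i\in A$ and $v_A(i)=1$ for $i\notin A$. Realizable means realizable over $\mathbb{R}$ as an oriented matroid. -}

module Defs where

open import Algebra.Bundles using (CommutativeRing)
import Algebra.Properties.Monoid.Sum as MonoidSum
open import Data.Bool.Base using (Bool; true; false; if_then_else_)
open import Data.Fin.Base using (Fin)
open import Data.Fin.Properties using (_≟_; 2↔Bool; +↔⊎; *↔×)
open import Data.Fin.Subset using (Subset)
open import Data.Nat.Base as ℕ using (ℕ; zero; suc)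
open import Data.Product.Base using (Σ; ∃; ∃-syntax; _×_; _,_; uncurry)
open import Data.Product.Function.NonDependent.Propositional using (_×-↔_)
open import Data.Sum.Base using (_⊎_; inj₁; inj₂)
open import Data.Sum.Function.Propositional using (_⊎-↔_)
open import Data.Vec.Base using (Vec; []; _∷_; lookup; head; tail)
open import Data.Vec.Functional as Vector using (Vector)
open import Function.Base using (_∘_)
open import Function.Bundles using (_↔_; _⇔_; Inverse; mk↔ₛ′)
open import Function.Construct.Composition using (_↔-∘_)
open import Function.Construct.Identity using (↔-id)
open import Function.Definitions using (Injective)
open import Level using (0ℓ)
open import Relation.Binary.Core using (Rel)
open import Relation.Binary.PropositionalEquality.Core
  using (_≡_; _≢_; _≗_; refl)
open import Relation.Binary.Structures using (IsStrictTotalOrder)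
open import Relation.Nullary using (¬_)
open import Relation.Nullary.Decidable using (does)

-- ℝ is given by its axioms, as a Dedekind-complete ordered field; these
-- determine it up to unique isomorphism.  Equality is the ring's _≈_.

record RealNumbers : Set₁ where
  infix 4 _<_ _≤_
  field
    commutativeRing : CommutativeRing 0ℓ 0ℓ

  open CommutativeRing commutativeRing public

  field
    _<_                : Rel Carrier 0ℓ
    isStrictTotalOrder : IsStrictTotalOrder _≈_ _<_
    0<1                : 0# < 1#
    +-monoʳ-<          : ∀ x {y z} → y < z → x + y < x + z
    *-positive         : ∀ {x y} → 0# < x → 0# < y → 0# < x * y
    inverse            : ∀ x → ¬ (x ≈ 0#) → ∃[ y ] x * y ≈ 1#

  _≤_ : Rel Carrier 0ℓ
  x ≤ y = ¬ (y < x)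

  UpperBound : (Carrier → Set) → Carrier → Set
  UpperBound P u = ∀ x → P x → x ≤ u

  field
    supremum : ∀ (P : Carrier → Set) → ∃ P → ∃ (UpperBound P) →
               ∃[ s ] (UpperBound P s × (∀ u → UpperBound P u → s ≤ u))

record FiniteSet : Set₁ where
  field
    Carrier : Set
    size    : ℕ
    enum    : Fin size ↔ Carrier

open FiniteSet public using () renaming (Carrier to ∣_∣)

data Sign : Set where
  pos nil neg : Sign

opposite : Sign → Sign
opposite pos = neg
opposite nil = nil
opposite neg = pos

infixl 7 _·_
_·_ : Sign → Sign → Sign
pos · t = t
nil · t = nil
neg · t = opposite t

-- X = (X⁺ , X⁻) is encoded by its sign function: X⁺ = X⁻¹(pos) and
-- X⁻ = X⁻¹(neg).  Signed sets are compared pointwise, by _≗_.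

SignedSet : FiniteSet → Set
SignedSet E = ∣ E ∣ → Sign

infix 8 −_
−_ : ∀ {E : Set} → (E → Sign) → (E → Sign)
(− X) e = opposite (X e)

Nonempty : ∀ {E : Set} → (E → Sign) → Set
Nonempty X = ∃[ e ] X e ≢ nil

-- Inclusion of supports.
infix 4 _⊑_ _⊥_
_⊑_ : ∀ {E : Set} → (E → Sign) → (E → Sign) → Set
X ⊑ Y = ∀ e → X e ≢ nil → Y e ≢ nil

_⊥_ : ∀ {E : Set} → (E → Sign) → (E → Sign) → Set
X ⊥ Y = (∀ e → X e · Y e ≡ nil)
      ⊎ (∃[ e ] X e · Y e ≡ pos) × (∃[ f ] X f · Y f ≡ neg)

-- An oriented matroid on E is given by its set of signed circuits.
SignedSets : FiniteSet → Set₁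
SignedSets E = SignedSet E → Set

record IsOrientedMatroid {E : FiniteSet} (C : SignedSets E) : Set where
  field
    -- C is a set of signed sets, which are equal when pointwise equal.
    respects       : ∀ {X Y} → X ≗ Y → C X → C Y
    nonempty       : ∀ {X} → C X → Nonempty X
    symmetric      : ∀ {X} → C X → C (− X)
    incomparable   : ∀ {X Y} → C X → C Y → X ⊑ Y → X ≗ Y ⊎ X ≗ − Y
    elimination    : ∀ {X Y} → C X → C Y → ¬ (X ≗ − Y) →
                     ∀ e → X e ≡ pos → Y e ≡ neg →
                     ∃[ Z ] (C Z
                       × (∀ f → Z f ≡ pos → f ≢ e × (X f ≡ pos ⊎ Y f ≡ pos))
                       × (∀ f → Z f ≡ neg → f ≢ e × (X f ≡ neg ⊎ Y f ≡ neg)))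

module _ {E : FiniteSet} (C : SignedSets E) where

  -- A family of distinct elements of E stands for the subset it enumerates.
  Independent : ∀ {s} → (Fin s → ∣ E ∣) → Set
  Independent b = Injective _≡_ _≡_ b
                × (∀ X → C X → ¬ (∀ e → X e ≢ nil → ∃[ j ] b j ≡ e))

  HasRank : ℕ → Set
  HasRank r = (∃[ b ] Independent {r} b)
            × (∀ {s} (b : Fin s → ∣ E ∣) → Independent b → s ℕ.≤ r)

  Covector : SignedSets E
  Covector Z = ∀ X → C X → X ⊥ Z

  -- The signed circuits of the dual: the nonempty signed sets of minimal
  -- support among those orthogonal to every signed circuit.
  Cocircuit : SignedSets E
  Cocircuit Z = Covector Z × Nonempty Z
              × (∀ W → Covector W → Nonempty W → W ⊑ Z → Z ⊑ W)

-- Isomorphism of oriented matroids (no reorientation is allowed).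
infix 4 _≅_
_≅_ : ∀ {E F} → SignedSets E → SignedSets F → Set
_≅_ {E} {F} C D =
  Σ (∣ E ∣ ↔ ∣ F ∣) λ φ → ∀ (X : SignedSet F) → D X ⇔ C (X ∘ Inverse.to φ)

-- D lists exactly one member of each pair ± of signed cocircuits of C.
record IsCocircuitSystem {E K : FiniteSet} (C : SignedSets E)
                         (D : ∣ K ∣ → SignedSet E) : Set where
  field
    cocircuit  : ∀ k → Cocircuit {E} C (D k)
    exhaustive : ∀ Z → Cocircuit {E} C Z → ∃[ k ] (Z ≗ D k ⊎ Z ≗ − (D k))
    distinct   : ∀ k l → D k ≗ D l ⊎ D k ≗ − (D l) → k ≡ l

-- The oriented matroid with signed circuits C̃, on the ground set K
-- indexing D, is an adjoint with respect to D of the oriented matroid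
-- of rank r with signed circuits C.  For e ∈ E the signed set
-- ({k : e ∈ (D k)⁺} , {k : e ∈ (D k)⁻}) has sign function k ↦ D k e.
record IsAdjoint {E K : FiniteSet} (C : SignedSets E) (r : ℕ)
                 (D : ∣ K ∣ → SignedSet E) (C̃ : SignedSets K) : Set where
  field
    isOrientedMatroid  : IsOrientedMatroid {E} C
    rank               : HasRank {E} C r
    isCocircuitSystem  : IsCocircuitSystem {E} {K} C D
    isOrientedMatroid˜ : IsOrientedMatroid {K} C̃
    rank˜              : HasRank {K} C̃ r
    cocircuit˜         : ∀ e → Cocircuit {K} C̃ (λ k → D k e)

-- inj₁ i is i ∈ [n], and inj₂ i is i′ ∈ [n]′.
[_]⊎[_]′ : ℕ → ℕ → FiniteSet
[ m ]⊎[ n ]′ = record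
  { Carrier = Fin m ⊎ Fin n
  ; size    = m ℕ.+ n
  ; enum    = +↔⊎
  }

subsets : ∀ n → Fin (2 ℕ.^ n) ↔ Subset n
subsets zero    = mk↔ₛ′ (λ _ → []) (λ _ → Fin.zero)
                        (λ { [] → refl }) (λ { Fin.zero → refl ; (Fin.suc ()) })
subsets (suc n) = cons ↔-∘ ((2↔Bool ×-↔ subsets n) ↔-∘ *↔×)
  where
  cons : (Bool × Subset n) ↔ Subset (suc n)
  cons = mk↔ₛ′ (uncurry _∷_) (λ A → head A , tail A)
               (λ { (_ ∷ _) → refl }) (λ _ → refl)

-- 𝐘 i names Yᵢ, and 𝐗 A names X_{A′}.
pattern 𝐘 i = inj₁ i
pattern 𝐗 A = inj₂ A

𝓓₁ : ℕ → FiniteSet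
𝓓₁ n = record
  { Carrier = Fin n ⊎ Subset n
  ; size    = n ℕ.+ 2 ℕ.^ n
  ; enum    = (↔-id (Fin n) ⊎-↔ subsets n) ↔-∘ +↔⊎
  }

D₁ : ∀ {n} → ∣ 𝓓₁ n ∣ → SignedSet [ n ]⊎[ n ]′
D₁ (𝐘 j) (inj₁ i) = if does (i ≟ j) then pos else nil
D₁ (𝐘 j) (inj₂ i) = if does (i ≟ j) then neg else nil
D₁ (𝐗 A) (inj₁ i) = if lookup A i then nil else pos
D₁ (𝐗 A) (inj₂ i) = if lookup A i then pos else nil

module _ (ℝ : RealNumbers) where
  private module ℝ = RealNumbers ℝ
  open ℝ using (_≈_; _<_; _*_; -_; 0#; 1#)

  ∑ : (E : FiniteSet) → (∣ E ∣ → ℝ.Carrier) → ℝ.Carrier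
  ∑ E f = MonoidSum.sum ℝ.+-monoid (f ∘ Inverse.to (FiniteSet.enum E))

  HasSign : ℝ.Carrier → Sign → Set
  HasSign x pos = 0# < x
  HasSign x nil = x ≈ 0#
  HasSign x neg = x < 0#

  module _ {E : FiniteSet} {d : ℕ} (v : ∣ E ∣ → Vector ℝ.Carrier d) where

    LinearDependency : (∣ E ∣ → ℝ.Carrier) → Set
    LinearDependency a = ∀ i → ∑ E (λ e → a e * v e i) ≈ 0#

    AffineDependency : (∣ E ∣ → ℝ.Carrier) → Set
    AffineDependency a = LinearDependency a × ∑ E a ≈ 0#

  module _ {E : FiniteSet} (Dependency : (∣ E ∣ → ℝ.Carrier) → Set) where

    Vectors : SignedSets E
    Vectors X = ∃[ a ] (Dependency a × (∀ e → HasSign (a e) (X e)))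

    -- Sign vectors of dependencies of minimal nonempty support.
    Circuits : SignedSets E
    Circuits X = Vectors X × Nonempty X
               × (∀ W → Vectors W → Nonempty W → W ⊑ X → X ⊑ W)

  LinearMatroid : ∀ {E d} → (∣ E ∣ → Vector ℝ.Carrier d) → SignedSets E
  LinearMatroid {E} v = Circuits {E} (LinearDependency {E} v)

  AffineMatroid : ∀ {E d} → (∣ E ∣ → Vector ℝ.Carrier d) → SignedSets E
  AffineMatroid {E} v = Circuits {E} (AffineDependency {E} v)

  Realizable : ∀ {E} → SignedSets E → Set
  Realizable {E} C = ∃[ d ] Σ (∣ E ∣ → Vector ℝ.Carrier d) λ v →
                     ∀ X → C X ⇔ LinearMatroid {E} v X

  basis : ∀ {n} → Fin n → Vector ℝ.Carrier n
  basis i j = if does (i ≟ j) then 1# else 0#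

  crossPolytope : ∀ {n} → ∣ [ n ]⊎[ n ]′ ∣ → Vector ℝ.Carrier n
  crossPolytope (inj₁ i) j = basis i j
  crossPolytope (inj₂ i) j = - basis i j

  𝐎 : ∀ n → SignedSets [ n ]⊎[ n ]′
  𝐎 n = AffineMatroid {[ n ]⊎[ n ]′} crossPolytope

  cubeVertex : ∀ {n} → Subset n → Vector ℝ.Carrier n
  cubeVertex A i = if lookup A i then - 1# else 1#

  canonicalVector : ∀ {n} → ∣ 𝓓₁ n ∣ → Vector ℝ.Carrier (n ℕ.+ 1)
  canonicalVector (𝐘 i) = basis i      Vector.++ (0# Vector.∷ Vector.[])
  canonicalVector (𝐗 A) = cubeVertex A Vector.++ (1# Vector.∷ Vector.[])

  𝐎̃ : ∀ n → SignedSets (𝓓₁ n)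
  𝐎̃ n = LinearMatroid {𝓓₁ n} canonicalVector

{-# OPTIONS --safe #-}

-- Sign vectors of dependencies decompose conformally into circuits, so a
-- covector is orthogonal to every dependency, and in rank n + 1 a nonzero
-- linear functional is a cocircuit as soon as it vanishes on n independent elements.
-- This gives the cocircuits of 𝐎 and of 𝐎̃.
--
-- Uniqueness: orthogonality to X̃[i] and X̃[i′] makes X_∅, Y₁, …, Yₙ a basis of any
-- realizable adjoint, and in the coordinates of this basis it forces
-- X_{A′} = β_A (X_∅ − Σ_{i ∈ A} γᵢ Yᵢ) with β_A > 0 and γᵢ > 0 independent of A.
-- Up to positive scaling of its elements, this is the canonical realization,
-- where γᵢ = 2.

module Submission where

open import Defs
open import Data.Nat.Base using (ℕ; suc; _≤_)
open import Data.Product.Base using (_×_)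

open import Algebra.Bundles using (CommutativeRing)
import Algebra.Properties.Ring as RingProperties
import Algebra.Properties.Semiring.Sum as SemiringSum
open import Data.Bool.Base using (Bool; true; false; if_then_else_)
open import Data.Empty using (⊥-elim)
open import Data.Fin.Base as Fin using (Fin; zero; suc; punchIn; _↑ˡ_; _↑ʳ_)
open import Data.Fin.Properties as Fin using (_≟_; punchInᵢ≢i)
open import Data.Fin.Subset as Subset using (Subset; _∈_; _⊂_)
open import Data.Fin.Subset.Induction using (⊂-wellFounded)
import Data.Nat.Base as ℕ
import Data.Nat.Properties as ℕ
open import Data.Product.Base using (∃; ∃-syntax; _,_; proj₁; proj₂)
open import Data.Sum.Base using (_⊎_; inj₁; inj₂; [_,_]′)
open import Data.Sum.Properties using (inj₂-injective)
open import Data.Vec.Base using (lookup; tabulate)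
open import Data.Vec.Functional as Vector using (Vector; insertAt)
import Data.Vec.Functional.Properties as Vector
open import Data.Vec.Properties
  using (lookup∘tabulate; tabulate∘lookup; tabulate-cong; lookup-replicate;
         []=⇒lookup; lookup⇒[]=)
open import Function.Base using (_∘_; case_of_)
open import Function.Bundles using (_⇔_; Inverse; Equivalence; mk⇔)
open import Function.Construct.Composition using (_⇔-∘_)
open import Function.Construct.Identity using (↔-id; ⇔-id)
open import Function.Definitions using (Injective)
open import Induction.WellFounded as WF using (WellFounded; Acc; acc)
import Relation.Binary.Construct.On as On
open import Relation.Binary.Definitions using (tri<; tri≈; tri>)
open import Relation.Binary.PropositionalEquality as ≡ using (_≡_; _≢_; _≗_)
import Relation.Binary.Reasoning.Setoid as SetoidReasoning
open import Relation.Binary.Structures using (module IsStrictTotalOrder)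
open import Relation.Nullary using (¬_; Dec; yes; no; does; contradiction)
open import Relation.Nullary.Decidable using (_⊎-dec_)

-- Orthogonality speaks of signs only, while uniqueness needs equations between real coordinates.
-- The bridge: if the supports of a dependency and of a covector share at most one element, nothing
-- can balance the product there, so the dependency vanishes at it. The signed sets X̃[i] and X̃[i′]
-- have large zero sets, and each dependency of the uniqueness argument is chosen to meet one of
-- them in a single element, which gives an equation, or in two, which gives an inequality. The
-- canonical vectors are the coefficient vectors of the functionals x_j and 1 + ⟨v_A, x⟩ that cut
-- out the cocircuits of `𝐎`. Their values at the points ±e_i form one table of reals with sign
-- table `D₁`; fixing a functional gives a cocircuit of `𝐎`, fixing a point gives one of `𝐎̃`, so
-- one criterion serves both matroids. The constant 2 is the edge length of the cube: v_∅ - v_A is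
-- the sum of the 2 e_i over i ∈ A. A realization may live in any dimension, hence the passage to
-- coordinates in a basis taken from the ground set.

pos≢neg : pos ≢ neg
pos≢neg ()

pos≢nil : pos ≢ nil
pos≢nil ()

neg≢nil : neg ≢ nil
neg≢nil ()

infix 4 _≟ₛ_
_≟ₛ_ : (s t : Sign) → Dec (s ≡ t)
pos ≟ₛ pos = yes ≡.refl
pos ≟ₛ nil = no λ ()
pos ≟ₛ neg = no λ ()
nil ≟ₛ pos = no λ ()
nil ≟ₛ nil = yes ≡.refl
nil ≟ₛ neg = no λ ()
neg ≟ₛ pos = no λ ()
neg ≟ₛ nil = no λ ()
neg ≟ₛ neg = yes ≡.refl

opposite-involutive : ∀ s → opposite (opposite s) ≡ s
opposite-involutive pos = ≡.refl
opposite-involutive nil = ≡.refl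
opposite-involutive neg = ≡.refl

opposite-nil : ∀ {s} → opposite s ≡ nil → s ≡ nil
opposite-nil {nil} _ = ≡.refl

·-zeroʳ : ∀ s → s · nil ≡ nil
·-zeroʳ pos = ≡.refl
·-zeroʳ nil = ≡.refl
·-zeroʳ neg = ≡.refl

·-comm : ∀ s t → s · t ≡ t · s
·-comm pos pos = ≡.refl
·-comm pos nil = ≡.refl
·-comm pos neg = ≡.refl
·-comm nil t   = ≡.sym (·-zeroʳ t)
·-comm neg pos = ≡.refl
·-comm neg nil = ≡.refl
·-comm neg neg = ≡.refl

·-nil : ∀ s t → s · t ≡ nil → t ≢ nil → s ≡ nil
·-nil pos t eq t≢ = contradiction eq t≢
·-nil nil t eq t≢ = ≡.refl
·-nil neg pos () t≢
·-nil neg nil eq t≢ = contradiction ≡.refl t≢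
·-nil neg neg () t≢

-- Decidable equality and search on finite sets

module _ {E : FiniteSet} where
  private
    module E = Inverse (FiniteSet.enum E)

  infix 4 _≟ₑ_
  _≟ₑ_ : (e f : ∣ E ∣) → Dec (e ≡ f)
  e ≟ₑ f with E.from e ≟ E.from f
  ... | yes eq = yes (≡.trans (≡.sym (E.strictlyInverseˡ e))
                     (≡.trans (≡.cong E.to eq) (E.strictlyInverseˡ f)))
  ... | no neq = no λ eq → neq (≡.cong E.from eq)

  allFin : (P : ∣ E ∣ → Set) → (∀ i → P (E.to i)) → ∀ e → P e
  allFin P h e = ≡.subst P (E.strictlyInverseˡ e) (h (E.from e))

-- The alternatives need not be complementary, so either outcome can carry positive evidence, such
-- as a nonzero entry or vanishing everywhere.
searchFin : ∀ {m} {P Q : Fin m → Set} → (∀ i → P i ⊎ Q i) → ∃ P ⊎ (∀ i → Q i)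
searchFin {ℕ.zero} d = inj₂ λ ()
searchFin {suc m} d with d zero | searchFin (λ i → d (suc i))
... | inj₁ p | _              = inj₁ (zero , p)
... | inj₂ q | inj₁ (i , p)   = inj₁ (suc i , p)
... | inj₂ q | inj₂ qs        = inj₂ λ { zero → q ; (suc i) → qs i }

search : ∀ {E : FiniteSet} {P Q : ∣ E ∣ → Set} →
         (∀ e → P e ⊎ Q e) → ∃ P ⊎ (∀ e → Q e)
search {E} {P} {Q} d with searchFin (λ i → d (Inverse.to (FiniteSet.enum E) i))
... | inj₁ (i , p) = inj₁ (_ , p)
... | inj₂ q       = inj₂ (allFin {E} Q q)

dec⇒⊎ : ∀ {P : Set} → Dec P → P ⊎ ¬ P
dec⇒⊎ (yes p) = inj₁ p
dec⇒⊎ (no ¬p) = inj₂ ¬p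

-- Supports and orthogonality of sign vectors

module _ {E : FiniteSet} where
  private
    module E = Inverse (FiniteSet.enum E)

  infix 4 _◁_
  -- Strict inclusion of supports, with a witness so that it maps to the well-founded `_⊂_` of
  -- finite subsets. This is the measure for the descent to circuits.
  _◁_ : (X Y : SignedSet E) → Set
  X ◁ Y = X ⊑ Y × ∃[ e ] (X e ≡ nil × Y e ≢ nil)

  private
    nonnil : Sign → Bool
    nonnil pos = true
    nonnil nil = false
    nonnil neg = true

    nonnil-true : ∀ s → nonnil s ≡ true → s ≢ nil
    nonnil-true pos _ ()
    nonnil-true neg _ ()

    true-nonnil : ∀ s → s ≢ nil → nonnil s ≡ true
    true-nonnil pos h = ≡.refl
    true-nonnil nil h = contradiction ≡.refl h
    true-nonnil neg h = ≡.refl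

    support : SignedSet E → Subset (FiniteSet.size E)
    support X = tabulate (λ i → nonnil (X (E.to i)))

    ∈⇒ : ∀ X i → i ∈ support X → X (E.to i) ≢ nil
    ∈⇒ X i h = nonnil-true _ (≡.trans (≡.sym (lookup∘tabulate _ i)) ([]=⇒lookup h))

    ⇒∈ : ∀ X i → X (E.to i) ≢ nil → i ∈ support X
    ⇒∈ X i h = lookup⇒[]= i _ (≡.trans (lookup∘tabulate _ i) (true-nonnil _ h))

    ◁⇒⊂ : ∀ {X Y} → X ◁ Y → support X ⊂ support Y
    ◁⇒⊂ {X} {Y} (X⊑Y , e , Xe , Ye) =
        (λ {i} h → ⇒∈ Y i (X⊑Y _ (∈⇒ X i h)))
      , E.from e
      , ⇒∈ Y _ (≡.subst (λ e → Y e ≢ nil) (≡.sym (E.strictlyInverseˡ e)) Ye)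
      , λ h → ∈⇒ X _ h (≡.trans (≡.cong X (E.strictlyInverseˡ e)) Xe)

  ◁-wellFounded : WellFounded _◁_
  ◁-wellFounded = WF.Subrelation.wellFounded ◁⇒⊂
                    (On.wellFounded support ⊂-wellFounded)

-- No product survives away from `e` and `f`, so the positive and the negative product that
-- orthogonality demands must be these two. The case e = f is allowed; it forces the product to
-- vanish, which is `⊥-single`.
⊥-pair : ∀ {E : Set} {X Y : E → Sign} {e f} → X ⊥ Y →
         (∀ g → g ≢ e → g ≢ f → X g · Y g ≡ nil) →
         X e · Y e ≡ opposite (X f · Y f)
⊥-pair {e = e} {f} (inj₁ h) _ rewrite h e | h f = ≡.refl
⊥-pair {X = X} {Y} {e} {f} (inj₂ ((g , p) , (k , q))) h =
  combine (at g p pos≢nil) (at k q neg≢nil)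
  where
  at : ∀ {s} g → X g · Y g ≡ s → s ≢ nil → s ≡ X e · Y e ⊎ s ≡ X f · Y f
  at {s} g p s≢ with s ≟ₛ X e · Y e | s ≟ₛ X f · Y f
  ... | yes eq | _      = inj₁ eq
  ... | no _   | yes eq = inj₂ eq
  ... | no ne  | no nf  = contradiction (≡.trans (≡.sym p)
    (h g (λ { ≡.refl → ne (≡.sym p) }) (λ { ≡.refl → nf (≡.sym p) }))) s≢

  combine : ∀ {s t} → pos ≡ s ⊎ pos ≡ t → neg ≡ s ⊎ neg ≡ t → s ≡ opposite t
  combine (inj₁ ≡.refl) (inj₂ ≡.refl) = ≡.refl
  combine (inj₂ ≡.refl) (inj₁ ≡.refl) = ≡.refl
  combine (inj₁ ≡.refl) (inj₁ ())
  combine (inj₂ ≡.refl) (inj₂ ())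

⊥-single : ∀ {E : Set} {X Y : E → Sign} {e} → X ⊥ Y →
           (∀ f → f ≢ e → X f · Y f ≡ nil) → X e · Y e ≡ nil
⊥-single {X = X} {Y} {e} X⊥Y h = self-opposite (⊥-pair {X = X} {Y} {e} {e} X⊥Y (λ g g≢e _ → h g g≢e))
  where
  self-opposite : ∀ {s} → s ≡ opposite s → s ≡ nil
  self-opposite {nil} _ = ≡.refl
  self-opposite {pos} ()
  self-opposite {neg} ()

-- Signs of real numbers and of sums

module _ (ℝ : RealNumbers) where
  open RealNumbers ℝ hiding (zero; _≤_)
  open RingProperties (CommutativeRing.ring commutativeRing)
  open SemiringSum semiring
  open SetoidReasoning setoid
  private
    module < = IsStrictTotalOrder isStrictTotalOrder

  x<y⇒0<y-x : ∀ {x y} → x < y → 0# < y - x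
  x<y⇒0<y-x {x} {y} x<y =
    <.<-respˡ-≈ (-‿inverseˡ x) (<.<-respʳ-≈ (+-comm (- x) y) (+-monoʳ-< (- x) x<y))

  neg-pos : ∀ {x} → x < 0# → 0# < - x
  neg-pos {x} x<0 = <.<-respʳ-≈ (+-identityˡ (- x)) (x<y⇒0<y-x x<0)

  pos-neg : ∀ {x} → 0# < x → - x < 0#
  pos-neg {x} 0<x = <.<-respˡ-≈ (+-identityʳ (- x))
    (<.<-respʳ-≈ (-‿inverseˡ x) (+-monoʳ-< (- x) 0<x))

  1≉0 : 1# ≉ 0#
  1≉0 1≈0 = <.irrefl (sym 1≈0) 0<1

  ≈0? : ∀ x → x ≈ 0# ⊎ x ≉ 0#
  ≈0? x = dec⇒⊎ (x <.≟ 0#)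

  x*y≈0⇒y≈0 : ∀ {x y} → x ≉ 0# → x * y ≈ 0# → y ≈ 0#
  x*y≈0⇒y≈0 {x} {y} x≉0 xy≈0 with inverse x x≉0
  ... | z , xz≈1 = begin
    y           ≈⟨ *-identityˡ y ⟨
    1# * y      ≈⟨ *-congʳ xz≈1 ⟨
    x * z * y   ≈⟨ *-congʳ (*-comm x z) ⟩
    z * x * y   ≈⟨ *-assoc z x y ⟩
    z * (x * y) ≈⟨ *-congˡ xy≈0 ⟩
    z * 0#      ≈⟨ zeroʳ z ⟩
    0#          ∎

  sign : Carrier → Sign
  sign x with <.compare x 0#
  ... | tri< _ _ _ = neg
  ... | tri≈ _ _ _ = nil
  ... | tri> _ _ _ = pos

  hasSign : ∀ x → HasSign ℝ x (sign x)
  hasSign x with <.compare x 0#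
  ... | tri< p _ _ = p
  ... | tri≈ _ p _ = p
  ... | tri> _ _ p = p

  HasSign-cong : ∀ {x y} s → x ≈ y → HasSign ℝ x s → HasSign ℝ y s
  HasSign-cong pos eq h = <.<-respʳ-≈ eq h
  HasSign-cong nil eq h = trans (sym eq) h
  HasSign-cong neg eq h = <.<-respˡ-≈ eq h

  HasSign-unique : ∀ {x} s t → HasSign ℝ x s → HasSign ℝ x t → s ≡ t
  HasSign-unique pos pos h k = ≡.refl
  HasSign-unique pos nil h k = ⊥-elim (<.irrefl (sym k) h)
  HasSign-unique pos neg h k = ⊥-elim (<.asym h k)
  HasSign-unique nil pos h k = ⊥-elim (<.irrefl (sym h) k)
  HasSign-unique nil nil h k = ≡.refl
  HasSign-unique nil neg h k = ⊥-elim (<.irrefl h k)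
  HasSign-unique neg pos h k = ⊥-elim (<.asym h k)
  HasSign-unique neg nil h k = ⊥-elim (<.irrefl k h)
  HasSign-unique neg neg h k = ≡.refl

  sign-unique : ∀ {x} s → HasSign ℝ x s → sign x ≡ s
  sign-unique {x} s h = HasSign-unique _ s (hasSign x) h

  HasSign-0 : ∀ {x s} → HasSign ℝ x s → x ≈ 0# → s ≡ nil
  HasSign-0 {s = s} h x≈0 = HasSign-unique s nil h x≈0

  HasSign-≉0 : ∀ {x s} → HasSign ℝ x s → x ≉ 0# → s ≢ nil
  HasSign-≉0 h x≉0 ≡.refl = x≉0 h

  HasSign-nonnil : ∀ {x s} → HasSign ℝ x s → s ≢ nil → x ≉ 0#
  HasSign-nonnil h s≢nil x≈0 = s≢nil (HasSign-0 h x≈0)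

  HasSign-neg : ∀ {x} s → HasSign ℝ x s → HasSign ℝ (- x) (opposite s)
  HasSign-neg pos h = pos-neg h
  HasSign-neg nil h = trans (-‿cong h)  -0#≈0#
  HasSign-neg neg h = neg-pos h

  HasSign-*-pos : ∀ {x y} t → 0# < x → HasSign ℝ y t → HasSign ℝ (x * y) t
  HasSign-*-pos pos h k = *-positive h k
  HasSign-*-pos {x} nil h k = trans (*-congˡ k) (zeroʳ x)
  HasSign-*-pos {x} {y} neg h k = HasSign-cong neg
    (trans (-‿cong (sym (-‿distribʳ-* x y))) (-‿involutive (x * y)))
    (HasSign-neg pos (*-positive h (neg-pos k)))

  HasSign-* : ∀ {x y} s t → HasSign ℝ x s → HasSign ℝ y t →
              HasSign ℝ (x * y) (s · t)
  HasSign-* pos t h k = HasSign-*-pos t h k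
  HasSign-* {x} {y} nil t h k = trans (*-congʳ h) (zeroˡ y)
  HasSign-* {x} {y} neg t h k = HasSign-cong (opposite t)
    (trans (-‿cong (sym (-‿distribˡ-* x y))) (-‿involutive (x * y)))
    (HasSign-neg t (HasSign-*-pos t (neg-pos h) k))

  HasSign-+ : ∀ {x y} s → HasSign ℝ x s → HasSign ℝ y s → HasSign ℝ (x + y) s
  HasSign-+ {x} {y} pos h k = <.trans h (<.<-respˡ-≈ (+-identityʳ x) (+-monoʳ-< x k))
  HasSign-+ nil h k = trans (+-cong h k) (+-identityʳ 0#)
  HasSign-+ {x} {y} neg h k = <.trans (<.<-respʳ-≈ (+-identityʳ x) (+-monoʳ-< x k)) h

  0<1+1 : 0# < 1# + 1#
  0<1+1 = HasSign-+ pos 0<1 0<1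

  -- Nonzero terms of equal sign cannot cancel. Contrapositively, a vanishing sum has only zero
  -- terms or terms of both signs, which is the dichotomy in the definition of `_⊥_`.
  sum-sign : ∀ {m} (f : Vector Carrier m) (s : Fin m → Sign) t →
             (∀ i → HasSign ℝ (f i) (s i)) → (∀ i → s i ≢ nil → s i ≡ t) →
             (∀ i → s i ≡ nil) ⊎ HasSign ℝ (sum f) t
  sum-sign {ℕ.zero} f s t h k = inj₁ λ ()
  sum-sign {suc m} f s t h k
    with s zero in eq | h zero | k zero
       | sum-sign (f ∘ suc) (s ∘ suc) t (h ∘ suc) (k ∘ suc)
  ... | nil | h₀ | _  | inj₁ z = inj₁ λ { zero → eq ; (suc i) → z i }
  ... | nil | h₀ | _  | inj₂ p =
    inj₂ (HasSign-cong t (sym (trans (+-congʳ h₀) (+-identityˡ _))) p)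
  ... | pos | h₀ | k₀ | r rewrite ≡.sym (k₀ pos≢nil) = inj₂ (add r)
    where
    add : (∀ i → s (suc i) ≡ nil) ⊎ HasSign ℝ (sum (f ∘ suc)) pos → HasSign ℝ (sum f) pos
    add (inj₁ z) = HasSign-cong pos (sym (trans (+-congˡ (trans
      (sum-cong-≋ (λ i → ≡.subst (HasSign ℝ (f (suc i))) (z i) (h (suc i))))
      (sum-replicate-zero m))) (+-identityʳ _))) h₀
    add (inj₂ p) = HasSign-+ pos h₀ p
  ... | neg | h₀ | k₀ | r rewrite ≡.sym (k₀ neg≢nil) = inj₂ (add r)
    where
    add : (∀ i → s (suc i) ≡ nil) ⊎ HasSign ℝ (sum (f ∘ suc)) neg → HasSign ℝ (sum f) neg
    add (inj₁ z) = HasSign-cong neg (sym (trans (+-congˡ (trans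
      (sum-cong-≋ (λ i → ≡.subst (HasSign ℝ (f (suc i))) (z i) (h (suc i))))
      (sum-replicate-zero m))) (+-identityʳ _))) h₀
    add (inj₂ p) = HasSign-+ neg h₀ p

  sum-zero : ∀ {m} {f : Vector Carrier m} → (∀ i → f i ≈ 0#) → sum f ≈ 0#
  sum-zero {m} h = trans (sum-cong-≋ h) (sum-replicate-zero m)

  sum-single : ∀ {m} (f : Vector Carrier m) i → (∀ j → j ≢ i → f j ≈ 0#) → sum f ≈ f i
  sum-single {suc m} f i h = begin
    sum f                        ≈⟨ sum-remove {i = i} f ⟩
    f i + sum (f ∘ punchIn i)    ≈⟨ +-congˡ (sum-zero λ j → h _ (punchInᵢ≢i i j)) ⟩
    f i + 0#                     ≈⟨ +-identityʳ (f i) ⟩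
    f i                          ∎

  x*yz≈y*xz : ∀ x y z → x * (y * z) ≈ y * (x * z)
  x*yz≈y*xz x y z = trans (sym (*-assoc x y z)) (trans (*-congʳ (*-comm x y)) (*-assoc y x z))

  dot : ∀ {m} → Vector Carrier m → Vector Carrier m → Carrier
  dot a f = sum (λ i → a i * f i)

  dot-cong : ∀ {m} {a b f g : Vector Carrier m} →
             (∀ i → a i ≈ b i) → (∀ i → f i ≈ g i) → dot a f ≈ dot b g
  dot-cong h k = sum-cong-≋ λ i → *-cong (h i) (k i)

  dot-linearʳ : ∀ {m} (a f g : Vector Carrier m) c →
                dot a (λ i → f i + c * g i) ≈ dot a f + c * dot a g
  dot-linearʳ a f g c = begin
    dot a (λ i → f i + c * g i)                  ≈⟨ sum-cong-≋ (λ i → distribˡ (a i) _ _) ⟩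
    sum (λ i → a i * f i + a i * (c * g i))      ≈⟨ ∑-distrib-+ (λ i → a i * f i) (λ i → a i * (c * g i)) ⟩
    dot a f + sum (λ i → a i * (c * g i))        ≈⟨ +-congˡ (sum-cong-≋ λ i → x*yz≈y*xz (a i) c (g i)) ⟩
    dot a f + sum (λ i → c * (a i * g i))        ≈⟨ +-congˡ (sym (*-distribˡ-sum c (λ i → a i * g i))) ⟩
    dot a f + c * dot a g                        ∎

  dot-negʳ : ∀ {m} (a f : Vector Carrier m) → dot a (λ i → - f i) ≈ - dot a f
  dot-negʳ a f = begin
    dot a (λ i → - f i)                 ≈⟨ sum-cong-≋ (λ i → trans (*-congˡ (sym (-1*x≈-x (f i))))
                                             (x*yz≈y*xz (a i) (- 1#) (f i))) ⟩
    sum (λ i → - 1# * (a i * f i))      ≈⟨ *-distribˡ-sum (- 1#) (λ i → a i * f i) ⟨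
    - 1# * dot a f                      ≈⟨ -1*x≈-x _ ⟩
    - dot a f                           ∎

  -- Gaussian elimination for homogeneous systems

  Solution : ∀ {r m} → (Fin r → Vector Carrier m) → Vector Carrier m → Set
  Solution f a = ∀ j → dot a (f j) ≈ 0#

  Nontrivial Trivial : ∀ {r m} → (Fin r → Vector Carrier m) → Set
  Nontrivial f = ∃[ a ] Solution f a × (∃[ i ] a i ≉ 0#)
  Trivial    f = ∀ a → Solution f a → ∀ i → a i ≈ 0#

  -- The equations left after the unknown i has been eliminated by means of
  -- the equation 0, whose coefficient at i has the inverse c.
  eliminate : ∀ {r m} → (Fin (suc r) → Vector Carrier (suc m)) → Fin (suc m) → Carrier →
              Fin r → Vector Carrier m
  eliminate f i c j k =
    f (suc j) (punchIn i k) + - (c * f (suc j) i) * f zero (punchIn i k)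

  eliminate-dot : ∀ {r m} (f : Fin (suc r) → Vector Carrier (suc m)) i c →
                  f zero i * c ≈ 1# → ∀ a → dot a (f zero) ≈ 0# → ∀ j →
                  dot (a ∘ punchIn i) (eliminate f i c j) ≈ dot a (f (suc j))
  eliminate-dot f i c fc≈1 a eq j = begin
    dot a′ (eliminate f i c j)              ≈⟨ dot-linearʳ a′ (g ∘ punchIn i) (h ∘ punchIn i) (- (c * g i)) ⟩
    dot a′ (g ∘ punchIn i) + - (c * g i) * S ≈⟨ +-congˡ (*-congˡ S≈) ⟩
    dot a′ (g ∘ punchIn i) + - (c * g i) * - (a i * h i) ≈⟨ +-congˡ cancel ⟩
    dot a′ (g ∘ punchIn i) + a i * g i      ≈⟨ +-comm _ _ ⟩
    a i * g i + dot a′ (g ∘ punchIn i)      ≈⟨ sum-remove {i = i} (λ k → a k * g k) ⟨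
    dot a g                                 ∎
    where
    a′ = a ∘ punchIn i
    g = f (suc j)
    h = f zero
    S = dot a′ (h ∘ punchIn i)

    S≈ : S ≈ - (a i * h i)
    S≈ = +-inverseʳ-unique (a i * h i) S
           (trans (sym (sum-remove {i = i} (λ k → a k * h k))) eq)

    cancel : - (c * g i) * - (a i * h i) ≈ a i * g i
    cancel = begin
      - (c * g i) * - (a i * h i) ≈⟨ -x*-y≈x*y _ _ ⟩
      (c * g i) * (a i * h i)     ≈⟨ *-cong (*-comm c (g i)) (*-comm (a i) (h i)) ⟩
      (g i * c) * (h i * a i)     ≈⟨ *-assoc (g i) c _ ⟩
      g i * (c * (h i * a i))     ≈⟨ *-congˡ (*-assoc c (h i) (a i)) ⟨
      g i * (c * h i * a i)       ≈⟨ *-congˡ (*-congʳ (trans (*-comm c (h i)) fc≈1)) ⟩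
      g i * (1# * a i)            ≈⟨ *-congˡ (*-identityˡ (a i)) ⟩
      g i * a i                   ≈⟨ *-comm (g i) (a i) ⟩
      a i * g i                   ∎
      where
      -x*-y≈x*y : ∀ x y → - x * - y ≈ x * y
      -x*-y≈x*y x y = trans (sym (-‿distribˡ-* x (- y)))
        (trans (-‿cong (sym (-‿distribʳ-* x y))) (-‿involutive (x * y)))

  eliminate-lift : ∀ {r m} (f : Fin (suc r) → Vector Carrier (suc m)) i c →
                   f zero i * c ≈ 1# → Nontrivial (eliminate f i c) → Nontrivial f
  eliminate-lift f i c fc≈1 (b , sol , (k , bk≉0)) =
      a
    , (λ { zero → a₀ ; (suc j) → begin
        dot a (f (suc j))                             ≈⟨ eliminate-dot f i c fc≈1 a a₀ j ⟨
        dot (a ∘ punchIn i) (eliminate f i c j)       ≈⟨ dot-cong a∘ (λ _ → refl) ⟩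
        dot b (eliminate f i c j)                     ≈⟨ sol j ⟩
        0#                                            ∎ })
    , punchIn i k , (λ ak≈0 → bk≉0 (trans (sym (a∘ k)) ak≈0))
    where
    S = dot b (f zero ∘ punchIn i)
    a = insertAt b i (- (c * S))

    a∘ : ∀ k → a (punchIn i k) ≈ b k
    a∘ k = reflexive (Vector.insertAt-punchIn b i _ k)

    a₀ : dot a (f zero) ≈ 0#
    a₀ = begin
      dot a (f zero)
        ≈⟨ sum-remove {i = i} (λ k → a k * f zero k) ⟩
      a i * f zero i + dot (a ∘ punchIn i) (f zero ∘ punchIn i)
        ≈⟨ +-cong (*-congʳ (reflexive (Vector.insertAt-lookup b i _))) (dot-cong a∘ (λ _ → refl)) ⟩
      - (c * S) * f zero i + S
        ≈⟨ +-congʳ (-‿distribˡ-* (c * S) (f zero i)) ⟨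
      - (c * S * f zero i) + S
        ≈⟨ +-congʳ (-‿cong (trans (*-congʳ (*-comm c S)) (trans (*-assoc S c _)
             (trans (*-congˡ (trans (*-comm c _) fc≈1)) (*-identityʳ S))))) ⟩
      - S + S
        ≈⟨ -‿inverseˡ S ⟩
      0# ∎

  -- Elimination by recursion on the number of equations. The bound m ≤ r travels with triviality,
  -- so that the same induction yields `underdetermined`; all dimension arguments below rest on it.
  solve : ∀ r {m} (f : Fin r → Vector Carrier m) →
          Nontrivial f ⊎ (m ≤ r × Trivial f)
  solve ℕ.zero {ℕ.zero} f = inj₂ (ℕ.z≤n , λ _ _ ())
  solve ℕ.zero {suc m} f = inj₁ ((λ _ → 1#) , (λ ()) , zero , 1≉0)
  solve (suc r) {m} f with searchFin (λ i → [ inj₂ , inj₁ ]′ (≈0? (f zero i)))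
  solve (suc r) {m} f | inj₂ z with solve r (f ∘ suc)
  ... | inj₁ (a , sol , nz) = inj₁ (a , (λ
    { zero    → sum-zero λ i → trans (*-congˡ (z i)) (zeroʳ (a i))
    ; (suc j) → sol j }) , nz)
  ... | inj₂ (m≤r , triv) = inj₂ (ℕ.m≤n⇒m≤1+n m≤r , λ a sol → triv a (sol ∘ suc))
  solve (suc r) {suc m} f | inj₁ (i , fi≉0) with inverse (f zero i) fi≉0
  ... | c , fc≈1 with solve r (eliminate f i c)
  ...   | inj₁ nt = inj₁ (eliminate-lift f i c fc≈1 nt)
  ...   | inj₂ (m≤r , triv) = inj₂ (ℕ.s≤s m≤r , trivial)
    where
    trivial : Trivial f
    trivial a sol = everywhere
      where
      rest : ∀ k → a (punchIn i k) ≈ 0#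
      rest = triv (a ∘ punchIn i)
               (λ j → trans (eliminate-dot f i c fc≈1 a (sol zero) j) (sol (suc j)))

      at-i : a i ≈ 0#
      at-i = x*y≈0⇒y≈0 fi≉0 (begin
        f zero i * a i   ≈⟨ *-comm _ _ ⟩
        a i * f zero i   ≈⟨ +-identityʳ _ ⟨
        a i * f zero i + 0#
          ≈⟨ +-congˡ (sum-zero λ k → trans (*-congʳ (rest k)) (zeroˡ _)) ⟨
        a i * f zero i + dot (a ∘ punchIn i) (f zero ∘ punchIn i)
          ≈⟨ sum-remove {i = i} (λ k → a k * f zero k) ⟨
        dot a (f zero)   ≈⟨ sol zero ⟩
        0#               ∎)

      everywhere : ∀ k → a k ≈ 0#
      everywhere k with i ≟ k
      ... | yes ≡.refl = at-i
      ... | no i≢k = ≡.subst (λ k → a k ≈ 0#) (Fin.punchIn-punchOut i≢k) (rest _)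

  underdetermined : ∀ {r m} (f : Fin r → Vector Carrier m) → r ℕ.< m → Nontrivial f
  underdetermined f r<m with solve _ f
  ... | inj₁ nt        = nt
  ... | inj₂ (m≤r , _) = contradiction m≤r (ℕ.<⇒≱ r<m)

  module _ {p q m : ℕ} (f : Fin p → Vector Carrier m) (g : Fin q → Vector Carrier m)
           (a : Vector Carrier m) where

    Solution-++⁻ˡ : Solution (f Vector.++ g) a → Solution f a
    Solution-++⁻ˡ sol j =
      ≡.subst (λ h → dot a h ≈ 0#) (Vector.lookup-++ˡ f g j) (sol (j ↑ˡ q))

    Solution-++⁻ʳ : Solution (f Vector.++ g) a → Solution g a
    Solution-++⁻ʳ sol j =
      ≡.subst (λ h → dot a h ≈ 0#) (Vector.lookup-++ʳ f g j) (sol (p ↑ʳ j))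

    Solution-++⁺ : Solution f a → Solution g a → Solution (f Vector.++ g) a
    Solution-++⁺ solf solg j with Fin.splitAt p j
    ... | inj₁ i = solf i
    ... | inj₂ i = solg i

  basis-at : ∀ {m} (k : Fin m) → basis ℝ k k ≈ 1#
  basis-at k with k ≟ k
  ... | yes _ = refl
  ... | no ne = contradiction ≡.refl ne

  basis-off : ∀ {m} {k i : Fin m} → k ≢ i → basis ℝ k i ≈ 0#
  basis-off {k = k} {i} k≢i with k ≟ i
  ... | yes eq = contradiction eq k≢i
  ... | no _   = refl

  dot-basis : ∀ {m} (a : Vector Carrier m) k → dot a (basis ℝ k) ≈ a k
  dot-basis a k = trans
    (sum-single _ k λ i i≢k → trans (*-congˡ (basis-off (i≢k ∘ ≡.sym))) (zeroʳ (a i)))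
    (trans (*-congˡ (basis-at k)) (*-identityʳ (a k)))

-- Sums over finite sets

module Summation (ℝ : RealNumbers) (E : FiniteSet) where
  open RealNumbers ℝ hiding (zero; _≤_)
  open RingProperties (CommutativeRing.ring commutativeRing)
  open SemiringSum semiring
  open SetoidReasoning setoid
  private
    module E = Inverse (FiniteSet.enum E)

  ∑-cong : ∀ {f g : ∣ E ∣ → Carrier} → (∀ e → f e ≈ g e) → ∑ ℝ E f ≈ ∑ ℝ E g
  ∑-cong h = sum-cong-≋ (h ∘ E.to)

  ∑-zero : ∀ {f : ∣ E ∣ → Carrier} → (∀ e → f e ≈ 0#) → ∑ ℝ E f ≈ 0#
  ∑-zero h = sum-zero ℝ (h ∘ E.to)

  ∑-single : ∀ (f : ∣ E ∣ → Carrier) e → (∀ g → g ≢ e → f g ≈ 0#) → ∑ ℝ E f ≈ f e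
  ∑-single f e h = begin
    ∑ ℝ E f              ≈⟨ sum-single ℝ (f ∘ E.to) (E.from e) (λ j j≢ → h _ λ eq →
                              j≢ (≡.trans (≡.sym (E.strictlyInverseʳ j)) (≡.cong E.from eq))) ⟩
    f (E.to (E.from e))  ≈⟨ reflexive (≡.cong f (E.strictlyInverseˡ e)) ⟩
    f e                  ∎

  ∑-linearˡ : ∀ (a b φ : ∣ E ∣ → Carrier) c →
              ∑ ℝ E (λ e → (a e + c * b e) * φ e) ≈
              ∑ ℝ E (λ e → a e * φ e) + c * ∑ ℝ E (λ e → b e * φ e)
  ∑-linearˡ a b φ c = begin
    ∑ ℝ E (λ e → (a e + c * b e) * φ e)
      ≈⟨ ∑-cong (λ e → *-comm (a e + c * b e) (φ e)) ⟩
    dot ℝ (φ ∘ E.to) (λ i → a (E.to i) + c * b (E.to i))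
      ≈⟨ dot-linearʳ ℝ (φ ∘ E.to) (a ∘ E.to) (b ∘ E.to) c ⟩
    dot ℝ (φ ∘ E.to) (a ∘ E.to) + c * dot ℝ (φ ∘ E.to) (b ∘ E.to)
      ≈⟨ +-cong (∑-cong λ e → *-comm (φ e) (a e)) (*-congˡ (∑-cong λ e → *-comm (φ e) (b e))) ⟩
    ∑ ℝ E (λ e → a e * φ e) + c * ∑ ℝ E (λ e → b e * φ e) ∎

  ∑-linearʳ : ∀ (a φ ψ : ∣ E ∣ → Carrier) c →
              ∑ ℝ E (λ e → a e * (φ e + c * ψ e)) ≈
              ∑ ℝ E (λ e → a e * φ e) + c * ∑ ℝ E (λ e → a e * ψ e)
  ∑-linearʳ a φ ψ c = dot-linearʳ ℝ (a ∘ E.to) (φ ∘ E.to) (ψ ∘ E.to) c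

  ∑-distribˡ : ∀ c (f : ∣ E ∣ → Carrier) → c * ∑ ℝ E f ≈ ∑ ℝ E (λ e → c * f e)
  ∑-distribˡ c f = *-distribˡ-sum c (f ∘ E.to)

  ∑-distribʳ : ∀ c (f : ∣ E ∣ → Carrier) → ∑ ℝ E f * c ≈ ∑ ℝ E (λ e → f e * c)
  ∑-distribʳ c f = *-distribʳ-sum c (f ∘ E.to)

  ∑-comm-sum : ∀ {m} (f : ∣ E ∣ → Fin m → Carrier) →
               ∑ ℝ E (λ e → sum (f e)) ≈ sum (λ j → ∑ ℝ E (λ e → f e j))
  ∑-comm-sum f = ∑-comm (λ i j → f (E.to i) j)

  -- Pushforward of coefficients along `b`. Coefficients of repeated members add up, so `push-∑`
  -- holds for every family, injective or not.
  push : ∀ {s} → (Fin s → ∣ E ∣) → Vector Carrier s → ∣ E ∣ → Carrier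
  push b c e = sum (λ j → if does (_≟ₑ_ {E} (b j) e) then c j else 0#)

  if-≡ : ∀ {e f} x → e ≡ f → (if does (_≟ₑ_ {E} e f) then x else 0#) ≈ x
  if-≡ {e} {f} x eq with _≟ₑ_ {E} e f
  ... | yes _  = refl
  ... | no neq = contradiction eq neq

  if-≢ : ∀ {e f} x → e ≢ f → (if does (_≟ₑ_ {E} e f) then x else 0#) ≈ 0#
  if-≢ {e} {f} x neq with _≟ₑ_ {E} e f
  ... | yes eq = contradiction eq neq
  ... | no _   = refl

  push-∑ : ∀ {s} (b : Fin s → ∣ E ∣) c φ →
           ∑ ℝ E (λ e → push b c e * φ e) ≈ dot ℝ c (φ ∘ b)
  push-∑ b c φ = begin
    ∑ ℝ E (λ e → push b c e * φ e)
      ≈⟨ ∑-cong (λ e → *-distribʳ-sum (φ e) (term e)) ⟩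
    ∑ ℝ E (λ e → sum (λ j → term e j * φ e))
      ≈⟨ ∑-comm-sum (λ e j → term e j * φ e) ⟩
    sum (λ j → ∑ ℝ E (λ e → term e j * φ e))
      ≈⟨ sum-cong-≋ (λ j → trans
           (∑-single (λ e → term e j * φ e) (b j) (λ g g≢ →
              trans (*-congʳ (if-≢ (c j) (g≢ ∘ ≡.sym))) (zeroˡ (φ g))))
           (*-congʳ (if-≡ (c j) ≡.refl))) ⟩
    dot ℝ c (φ ∘ b) ∎
    where
    term : ∣ E ∣ → Vector Carrier _
    term e j = if does (_≟ₑ_ {E} (b j) e) then c j else 0#

  push-image : ∀ {s} {b : Fin s → ∣ E ∣} → Injective _≡_ _≡_ b →
               ∀ c j → push b c (b j) ≈ c j
  push-image {b = b} inj c j = trans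
    (sum-single ℝ _ j (λ i i≢j → if-≢ (c i) (i≢j ∘ inj)))
    (if-≡ (c j) ≡.refl)

  push-outside : ∀ {s} (b : Fin s → ∣ E ∣) c {e} → (∀ j → b j ≢ e) → push b c e ≈ 0#
  push-outside b c h = sum-zero ℝ λ j → if-≢ (c j) (h j)

  inImage? : ∀ {s} (b : Fin s → ∣ E ∣) e → (∃[ j ] b j ≡ e) ⊎ (∀ j → b j ≢ e)
  inImage? b e = searchFin λ j → dec⇒⊎ (_≟ₑ_ {E} (b j) e)

  ∑-image : ∀ {s} {b : Fin s → ∣ E ∣} → Injective _≡_ _≡_ b → ∀ a φ →
            (∀ e → a e ≉ 0# → ∃[ j ] b j ≡ e) →
            ∑ ℝ E (λ e → a e * φ e) ≈ dot ℝ (a ∘ b) (φ ∘ b)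
  ∑-image {b = b} inj a φ h =
    trans (∑-cong λ e → *-congʳ {φ e} (a≈push e)) (push-∑ b (a ∘ b) φ)
    where
    a≈push : ∀ e → a e ≈ push b (a ∘ b) e
    a≈push e with inImage? b e
    ... | inj₁ (j , ≡.refl) = sym (push-image inj (a ∘ b) j)
    ... | inj₂ miss with ≈0? ℝ (a e)
    ...   | inj₁ a≈0 = trans a≈0 (sym (push-outside b (a ∘ b) miss))
    ...   | inj₂ a≉0 = case h e a≉0 of λ (j , eq) → contradiction eq (miss j)

-- Reciprocals, signs of sums, and minima

module OrderedField (ℝ : RealNumbers) where
  open RealNumbers ℝ hiding (zero; _≤_)
  open RingProperties (CommutativeRing.ring commutativeRing)
  open SetoidReasoning setoid
  private
    module < = IsStrictTotalOrder isStrictTotalOrder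

  abstract
    -- recip 0# is 0#.
    recip : Carrier → Carrier
    recip x with ≈0? ℝ x
    ... | inj₁ _   = 0#
    ... | inj₂ x≉0 = proj₁ (inverse x x≉0)

    *-recip : ∀ {x} → x ≉ 0# → x * recip x ≈ 1#
    *-recip {x} x≉0 with ≈0? ℝ x
    ... | inj₁ x≈0  = contradiction x≈0 x≉0
    ... | inj₂ x≉0′ = proj₂ (inverse x x≉0′)

  recip-cancel : ∀ {x} y → x ≉ 0# → x * (y * recip x) ≈ y
  recip-cancel {x} y x≉0 = begin
    x * (y * recip x) ≈⟨ *-congˡ (*-comm y _) ⟩
    x * (recip x * y) ≈⟨ *-assoc x _ y ⟨
    x * recip x * y   ≈⟨ *-congʳ (*-recip x≉0) ⟩
    1# * y            ≈⟨ *-identityˡ y ⟩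
    y                 ∎

  recip-cancel′ : ∀ {x} y → x ≉ 0# → y + - (y * recip x) * x ≈ 0#
  recip-cancel′ {x} y x≉0 = begin
    y + - (y * recip x) * x ≈⟨ +-congˡ (trans (sym (-‿distribˡ-* _ x)) (-‿cong
                                 (trans (*-comm _ x) (recip-cancel y x≉0)))) ⟩
    y - y                   ≈⟨ -‿inverseʳ y ⟩
    0#                      ∎

  positive⇒≉0 : ∀ {x} → 0# < x → x ≉ 0#
  positive⇒≉0 0<x x≈0 = <.irrefl (sym x≈0) 0<x

  recip-positive : ∀ {x} → 0# < x → 0# < recip x
  recip-positive {x} 0<x with sign ℝ (recip x) in eq | hasSign ℝ (recip x)
  ... | pos | h = h
  ... | nil | h = contradiction (trans (sym (*-recip (positive⇒≉0 0<x)))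
                    (trans (*-congˡ h) (zeroʳ x))) (1≉0 ℝ)
  ... | neg | h = contradiction (HasSign-unique ℝ pos neg
                    0<1 (HasSign-cong ℝ neg (*-recip (positive⇒≉0 0<x))
                    (HasSign-* ℝ pos neg 0<x h))) pos≢neg

  HasSign-+-split : ∀ {x y s t u} → HasSign ℝ x s → HasSign ℝ y t →
                    HasSign ℝ (x + y) u → u ≢ nil → s ≡ u ⊎ t ≡ u
  HasSign-+-split {x} {y} {nil} {t} {u} h k l u≢ = inj₂ (HasSign-unique ℝ t u k
    (HasSign-cong ℝ u (trans (+-congʳ h) (+-identityˡ y)) l))
  HasSign-+-split {x} {y} {s} {nil} {u} h k l u≢ = inj₁ (HasSign-unique ℝ s u h
    (HasSign-cong ℝ u (trans (+-congˡ k) (+-identityʳ x)) l))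
  HasSign-+-split {s = pos} {pos} {u} h k l u≢ =
    inj₁ (HasSign-unique ℝ pos u (HasSign-+ ℝ pos h k) l)
  HasSign-+-split {s = neg} {neg} {u} h k l u≢ =
    inj₁ (HasSign-unique ℝ neg u (HasSign-+ ℝ neg h k) l)
  HasSign-+-split {s = pos} {neg} {pos} h k l u≢ = inj₁ ≡.refl
  HasSign-+-split {s = pos} {neg} {neg} h k l u≢ = inj₂ ≡.refl
  HasSign-+-split {s = neg} {pos} {pos} h k l u≢ = inj₂ ≡.refl
  HasSign-+-split {s = neg} {pos} {neg} h k l u≢ = inj₁ ≡.refl
  HasSign-+-split {s = pos} {neg} {nil} h k l u≢ = contradiction ≡.refl u≢
  HasSign-+-split {s = neg} {pos} {nil} h k l u≢ = contradiction ≡.refl u≢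

  argminFin : ∀ {m} {P : Fin m → Set} → (∀ i → Dec (P i)) → (r : Fin m → Carrier) →
              (∃[ k ] P k × (∀ l → P l → ¬ r l < r k)) ⊎ (∀ i → ¬ P i)
  argminFin {ℕ.zero} P? r = inj₂ λ ()
  argminFin {suc m} P? r with P? zero | argminFin (P? ∘ suc) (r ∘ suc)
  ... | no ¬p | inj₂ none = inj₂ λ { zero → ¬p ; (suc i) → none i }
  ... | no ¬p | inj₁ (k , pk , min) =
    inj₁ (suc k , pk , λ { zero p _ → ¬p p ; (suc l) → min l })
  ... | yes p | inj₂ none =
    inj₁ (zero , p , λ { zero _ → <.irrefl refl ; (suc l) pl _ → none l pl })
  ... | yes p | inj₁ (k , pk , min) with r zero <.<? r (suc k)
  ...   | yes r₀<rₖ = inj₁ (zero , p , λ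
    { zero _ → <.irrefl refl ; (suc l) pl rₗ<r₀ → min l pl (<.trans rₗ<r₀ r₀<rₖ) })
  ...   | no r₀≮rₖ  = inj₁ (suc k , pk , λ { zero _ → r₀≮rₖ ; (suc l) → min l })

  argmin : ∀ {E : FiniteSet} {P : ∣ E ∣ → Set} → (∀ e → Dec (P e)) → (r : ∣ E ∣ → Carrier) →
           ∃ P → ∃[ k ] P k × (∀ l → P l → ¬ r l < r k)
  argmin {E} {P} P? r (e , pe)
    with argminFin (λ i → P? (Inverse.to (FiniteSet.enum E) i)) (r ∘ Inverse.to (FiniteSet.enum E))
  ... | inj₁ (k , pk , min) = _ , pk , allFin {E} (λ l → P l → ¬ r l < _) min
  ... | inj₂ none = contradiction pe (allFin {E} (λ e → ¬ P e) none e)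

-- Circuits conformal to a dependency

module LinearMatroids (ℝ : RealNumbers) (E : FiniteSet) {d : ℕ}
                      (v : ∣ E ∣ → Vector (RealNumbers.Carrier ℝ) d) where
  open RealNumbers ℝ hiding (zero; _≤_)
  open RingProperties (CommutativeRing.ring commutativeRing)
  open SemiringSum semiring
  open SetoidReasoning setoid
  open Summation ℝ E public
  open OrderedField ℝ public
  private
    module E = Inverse (FiniteSet.enum E)
    module < = IsStrictTotalOrder isStrictTotalOrder

  Dep : (∣ E ∣ → Carrier) → Set
  Dep = LinearDependency ℝ {E} v

  Dep-cong : ∀ {a b} → (∀ e → a e ≈ b e) → Dep a → Dep b
  Dep-cong {a} {b} h dep i =
    trans (∑-cong λ e → *-congʳ {v e i} (sym (h e))) (dep i)

  Dep-combine : ∀ {a b} c → Dep a → Dep b → Dep (λ e → a e + c * b e)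
  Dep-combine {a} {b} c depa depb i = begin
    ∑ ℝ E (λ e → (a e + c * b e) * v e i) ≈⟨ ∑-linearˡ a b (λ e → v e i) c ⟩
    _ + c * _                             ≈⟨ +-cong (depa i) (*-congˡ (depb i)) ⟩
    0# + c * 0#                           ≈⟨ +-identityˡ _ ⟩
    c * 0#                                ≈⟨ zeroʳ c ⟩
    0#                                    ∎

  Dep-neg : ∀ {a} → Dep a → Dep (λ e → - a e)
  Dep-neg {a} dep = Dep-cong
    (λ e → trans (+-congˡ (-1*x≈-x (a e))) (+-identityˡ _))
    (Dep-combine {b = a} (- 1#) (λ i → ∑-zero λ e → zeroˡ (v e i)) dep)

  Dep-push : ∀ {s} (b : Fin s → ∣ E ∣) c →
             Solution ℝ (λ j i → v (b i) j) c → Dep (push b c)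
  Dep-push b c sol j = trans (push-∑ b c (λ e → v e j)) (sol j)

  infix 4 _≼_
  -- The conformal order on sign vectors.
  _≼_ : SignedSet E → SignedSet E → Set
  X ≼ Y = ∀ e → X e ≢ nil → X e ≡ Y e

  signs : (∣ E ∣ → Carrier) → SignedSet E
  signs a e = sign ℝ (a e)

  module _ {U : ∣ E ∣ → Set} (U? : ∀ e → Dec (U e)) where
    private
      rows : Fin d → Vector Carrier (FiniteSet.size E)
      rows j i = v (E.to i) j

      -- One equation per element, the zero equation outside `U`, so that the number of equations
      -- does not depend on `U`.
      vanishing : Fin (FiniteSet.size E) → Vector Carrier (FiniteSet.size E)
      vanishing k i = if does (U? (E.to k)) then basis ℝ k i else 0#

      vanishing⁻ : ∀ {a} → Solution ℝ vanishing a → ∀ k → U (E.to k) → a k ≈ 0#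
      vanishing⁻ {a} sol k u with U? (E.to k) | sol k
      ... | yes _ | eq = trans (sym (dot-basis ℝ a k)) eq
      ... | no ¬u | _  = contradiction u ¬u

      vanishing⁺ : ∀ {a} → (∀ k → U (E.to k) → a k ≈ 0#) → Solution ℝ vanishing a
      vanishing⁺ {a} h k with U? (E.to k)
      ... | yes u = trans (dot-basis ℝ a k) (h k u)
      ... | no _  = sum-zero ℝ λ i → zeroʳ (a i)

      from-to : ∀ (a : Fin (FiniteSet.size E) → Carrier) i → a (E.from (E.to i)) ≈ a i
      from-to a i = reflexive (≡.cong a (E.strictlyInverseʳ i))

    dependencyVanishingOn :
        (∃[ b ] Dep b × (∀ e → U e → b e ≈ 0#) × (∃[ e ] b e ≉ 0#))
      ⊎ (∀ b → Dep b → (∀ e → U e → b e ≈ 0#) → ∀ e → b e ≈ 0#)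
    dependencyVanishingOn with solve ℝ _ (rows Vector.++ vanishing)
    ... | inj₁ (a , sol , (k , ak≉0)) = inj₁
      ( a ∘ E.from
      , (λ j → trans (sum-cong-≋ λ i → *-congʳ (from-to a i)) (Solution-++⁻ˡ ℝ rows vanishing a sol j))
      , allFin {E} (λ e → U e → a (E.from e) ≈ 0#)
          (λ k u → trans (from-to a k) (vanishing⁻ (Solution-++⁻ʳ ℝ rows vanishing a sol) k u))
      , E.to k , λ eq → ak≉0 (trans (sym (from-to a k)) eq))
    ... | inj₂ (_ , triv) = inj₂ λ b dep van → allFin {E} (λ e → b e ≈ 0#)
      (triv (b ∘ E.to) (Solution-++⁺ ℝ rows vanishing (b ∘ E.to) dep (vanishing⁺ λ k → van (E.to k))))

  private
    Smaller : (∣ E ∣ → Carrier) → ∣ E ∣ → Set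
    Smaller a e = ∃[ c ] Dep c × _◁_ {E} (signs c) (signs a) × signs c ≼ signs a × c e ≉ 0#

    -- The ratios r = b / a of a dependency b to a dependency a with larger
    -- support: b − (min r) a is conformal to a, and loses exactly the
    -- elements at which r is minimal.
    module Shrink {a b : ∣ E ∣ → Carrier} (depa : Dep a) (depb : Dep b)
                  (b⊑a : ∀ e → a e ≈ 0# → b e ≈ 0#) where
      r : ∣ E ∣ → Carrier
      r e = b e * recip (a e)

      a-nonzero? : ∀ e → Dec (a e ≉ 0#)
      a-nonzero? e with ≈0? ℝ (a e)
      ... | inj₁ eq = no λ ne → ne eq
      ... | inj₂ ne = yes ne

      shrink : ∀ e f → a e ≉ 0# → a f ≉ 0# → r f < r e →
               Smaller a e
      shrink e f ae≉0 af≉0 rf<re with argmin {E} a-nonzero? r (f , af≉0)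
      ... | k , ak≉0 , min =
          c , Dep-combine {b} {a} (- r k) depb depa
        , (support , k , sign-unique ℝ nil (c-zero k (-‿inverseʳ (r k)))
                       , HasSign-≉0 ℝ (hasSign ℝ (a k)) ak≉0)
        , conformal
        -- The hypothesis r f < r e keeps `e` away from the minimum, so the coefficient at `e`
        -- survives.
        , λ ce≈0 → <.irrefl (sym (x∙y⁻¹≈ε⇒x≈y (r e) (r k)
            (x*y≈0⇒y≈0 ℝ ae≉0 (trans (sym (factor e ae≉0)) ce≈0)))) rk<re
        where
        c : ∣ E ∣ → Carrier
        c g = b g + - r k * a g

        factor : ∀ g → a g ≉ 0# → c g ≈ a g * (r g - r k)
        factor g ag≉0 = begin
          b g + - r k * a g          ≈⟨ +-cong (sym (recip-cancel (b g) ag≉0)) (*-comm (- r k) (a g)) ⟩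
          a g * r g + a g * - r k    ≈⟨ distribˡ (a g) (r g) (- r k) ⟨
          a g * (r g - r k)          ∎

        c-zero : ∀ g → r g - r k ≈ 0# → c g ≈ 0#
        c-zero g eq with ≈0? ℝ (a g)
        ... | inj₁ ag≈0 = trans (+-cong (b⊑a g ag≈0) (trans (*-congˡ ag≈0) (zeroʳ _))) (+-identityˡ 0#)
        ... | inj₂ ag≉0 = trans (factor g ag≉0) (trans (*-congˡ eq) (zeroʳ (a g)))

        conformal : signs c ≼ signs a
        conformal g cg≢nil with ≈0? ℝ (a g)
        ... | inj₁ ag≈0 = contradiction (sign-unique ℝ nil
          (trans (+-cong (b⊑a g ag≈0) (trans (*-congˡ ag≈0) (zeroʳ _))) (+-identityˡ 0#))) cg≢nil
        ... | inj₂ ag≉0 with <.compare (r k) (r g)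
        ...   | tri> _ _ rg<rk = contradiction rg<rk (min g ag≉0)
        ...   | tri≈ _ eq _ = contradiction (sign-unique ℝ nil
          (c-zero g (trans (+-congʳ (sym eq)) (-‿inverseʳ (r k))))) cg≢nil
        ...   | tri< rk<rg _ _ = sign-unique ℝ (signs a g) (HasSign-cong ℝ (signs a g)
          (trans (*-comm _ (a g)) (sym (factor g ag≉0)))
          (HasSign-* ℝ pos (signs a g) (x<y⇒0<y-x ℝ rk<rg) (hasSign ℝ (a g))))

        support : signs c ⊑ signs a
        support g cg≢nil ag≡nil = cg≢nil (≡.trans (conformal g cg≢nil) ag≡nil)

        rk<re : r k < r e
        rk<re with <.compare (r k) (r e)
        ... | tri< lt _ _ = lt
        ... | tri≈ _ eq _ = contradiction (<.<-respʳ-≈ (sym eq) rf<re) (min f af≉0)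
        ... | tri> _ _ gt = contradiction gt (min e ae≉0)

  sign≢nil⇒≉0 : ∀ {a e} → signs a e ≢ nil → a e ≉ 0#
  sign≢nil⇒≉0 ne eq = ne (sign-unique ℝ nil eq)

  ≉0⇒sign≢nil : ∀ {a : ∣ E ∣ → Carrier} {e} → a e ≉ 0# → signs a e ≢ nil
  ≉0⇒sign≢nil ne = HasSign-≉0 ℝ (hasSign ℝ _) ne

  private
    -- Minimality of the support, tested one element at a time: does a nonzero dependency live on
    -- the support of `a` without `f`? Each test is a linear system, hence decidable.
    Reducible Irreducible : (∣ E ∣ → Carrier) → ∣ E ∣ → Set
    Reducible   a f = a f ≉ 0# × (∃[ b ] Dep b × (∀ e → a e ≈ 0# ⊎ e ≡ f → b e ≈ 0#)
                                              × (∃[ e ] b e ≉ 0#))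
    Irreducible a f = a f ≈ 0# ⊎ (∀ b → Dep b → (∀ e → a e ≈ 0# ⊎ e ≡ f → b e ≈ 0#) →
                                  ∀ e → b e ≈ 0#)

    reducible? : ∀ a f → Reducible a f ⊎ Irreducible a f
    reducible? a f with ≈0? ℝ (a f)
    ... | inj₁ eq = inj₂ (inj₁ eq)
    ... | inj₂ ne with dependencyVanishingOn (λ e → (a e <.≟ 0#) ⊎-dec (_≟ₑ_ {E} e f))
    ...   | inj₁ nz   = inj₁ (ne , nz)
    ...   | inj₂ triv = inj₂ (inj₂ triv)

    irreducible⇒circuit : ∀ {a e} → Dep a → a e ≉ 0# → (∀ f → Irreducible a f) →
                          LinearMatroid ℝ {E} v (signs a)
    irreducible⇒circuit {a} {e} dep ae≉0 irr =
      (a , dep , λ e → hasSign ℝ (a e)) , (e , ≉0⇒sign≢nil {a} ae≉0) , minimal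
      where
      minimal : ∀ W → Vectors ℝ {E} Dep W → Nonempty W → W ⊑ signs a → signs a ⊑ W
      minimal W (b , depb , hasb) (g , Wg≢nil) W⊑ f af≢nil Wf≡nil with irr f
      ... | inj₁ eq = sign≢nil⇒≉0 {a} af≢nil eq
      ... | inj₂ triv = Wg≢nil (HasSign-0 ℝ (hasb g) (triv b depb
        (λ { h (inj₁ ah≈0) → vanish h ah≈0
           ; h (inj₂ ≡.refl) → ≡.subst (HasSign ℝ (b f)) Wf≡nil (hasb f) }) g))
        where
        vanish : ∀ h → a h ≈ 0# → b h ≈ 0#
        vanish h ah≈0 with ≈0? ℝ (b h)
        ... | inj₁ eq = eq
        ... | inj₂ ne = contradiction ah≈0 (sign≢nil⇒≉0 {a} (W⊑ h (HasSign-≉0 ℝ (hasb h) ne)))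

    -- The ratios b / a vanish at `f` and not at `g`, so at one of the two they differ from the
    -- ratio at `e`. After replacing b by -b if necessary, the ratio there is the smaller one, and
    -- `shrink` applies without losing `e`.
    reduce : ∀ {a e f} → Dep a → a e ≉ 0# → Reducible a f →
             Smaller a e
    reduce {a} {e} {f} depa ae≉0 (af≉0 , b , depb , van , (g , bg≉0)) = choose
      where
      b⊑a : ∀ e → a e ≈ 0# → b e ≈ 0#
      b⊑a e eq = van e (inj₁ eq)

      module S  = Shrink depa depb b⊑a
      module S⁻ = Shrink depa (Dep-neg {b} depb) (λ e eq → trans (-‿cong (b⊑a e eq)) -0#≈0#)

      ag≉0 : a g ≉ 0#
      ag≉0 eq = bg≉0 (b⊑a g eq)

      rf≈0 : S.r f ≈ 0#
      rf≈0 = trans (*-congʳ (van f (inj₂ ≡.refl))) (zeroˡ _)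

      r⁻≈-r : ∀ h → - S.r h ≈ S⁻.r h
      r⁻≈-r h = -‿distribˡ-* (b h) _

      rg≉0 : S.r g ≉ 0#
      rg≉0 eq = bg≉0 (trans (sym (recip-cancel (b g) ag≉0)) (trans (*-congˡ eq) (zeroʳ _)))

      flip : ∀ {x y} → x < y → - y < - x
      flip {x} {y} x<y = <.<-respˡ-≈ (+-identityʳ (- y)) (<.<-respʳ-≈
        (trans (sym (+-assoc _ _ _)) (trans (+-congʳ (-‿inverseˡ y)) (+-identityˡ _)))
        (+-monoʳ-< (- y) (x<y⇒0<y-x ℝ x<y)))

      different : ∀ h → a h ≉ 0# → S.r h ≉ S.r e →
                  Smaller a e
      different h ah≉0 ne with <.compare (S.r h) (S.r e)
      ... | tri< lt _ _ = S.shrink e h ae≉0 ah≉0 lt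
      ... | tri≈ _ eq _ = contradiction eq ne
      ... | tri> _ _ gt = S⁻.shrink e h ae≉0 ah≉0
        (<.<-respˡ-≈ (r⁻≈-r h) (<.<-respʳ-≈ (r⁻≈-r e) (flip gt)))

      choose : Smaller a e
      choose with ≈0? ℝ (S.r e)
      ... | inj₁ eq = different g ag≉0 (λ eq′ → rg≉0 (trans eq′ eq))
      ... | inj₂ ne = different f af≉0 (λ eq′ → ne (trans (sym eq′) rf≈0))

  -- Descent on the support: every reduction remains conformal and nonzero at `e`, and a dependency
  -- that admits none is a circuit. One circuit through each element of the support is all that
  -- orthogonality arguments ask of a conformal decomposition.
  conformalCircuit : ∀ {a} → Dep a → ∀ {e} → a e ≉ 0# →
                     ∃[ X ] LinearMatroid ℝ {E} v X × X e ≢ nil × X ≼ signs a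
  conformalCircuit {a} dep {e} ae≉0 = go dep ae≉0 (◁-wellFounded {E} (signs a))
    where
    go : ∀ {a} → Dep a → a e ≉ 0# → Acc (_◁_ {E}) (signs a) →
         ∃[ X ] LinearMatroid ℝ {E} v X × X e ≢ nil × X ≼ signs a
    go {a} dep ae≉0 (acc rec) with search {E} (reducible? a)
    ... | inj₂ irr = signs a , irreducible⇒circuit dep ae≉0 irr , ≉0⇒sign≢nil {a} ae≉0 , λ _ _ → ≡.refl
    ... | inj₁ (f , red) with reduce dep ae≉0 red
    ...   | c , depc , c◁a , c≼a , ce≉0 with go depc ce≉0 (rec c◁a)
    ...     | X , circ , Xe , X≼c = X , circ , Xe , λ g Xg →
      let eq = X≼c g Xg in ≡.trans eq (c≼a g (λ cg → Xg (≡.trans eq cg)))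

module _ (ℝ : RealNumbers) {E : FiniteSet} where
  open RealNumbers ℝ using (Carrier)

  -- Circuits see the dependencies only through their sign vectors. Homogenization, change of
  -- coordinates and positive rescaling all pass through this lemma.
  Circuits-cong : {D D′ : (∣ E ∣ → Carrier) → Set} →
                  (∀ X → Vectors ℝ {E} D X ⇔ Vectors ℝ {E} D′ X) →
                  ∀ X → Circuits ℝ {E} D X ⇔ Circuits ℝ {E} D′ X
  Circuits-cong D⇔D′ X = mk⇔
    (λ (vec , ne , minimal) → Equivalence.to (D⇔D′ X) vec , ne ,
      λ W vecW → minimal W (Equivalence.from (D⇔D′ W) vecW))
    (λ (vec , ne , minimal) → Equivalence.from (D⇔D′ X) vec , ne ,
      λ W vecW → minimal W (Equivalence.to (D⇔D′ W) vecW))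

-- Circuit axioms, covectors and independence in a realized matroid

module Realization (ℝ : RealNumbers) (E : FiniteSet) {d : ℕ}
                   (v : ∣ E ∣ → Vector (RealNumbers.Carrier ℝ) d) (C : SignedSets E)
                   (C⇔v : ∀ X → C X ⇔ LinearMatroid ℝ {E} v X) where
  open RealNumbers ℝ hiding (zero; _≤_)
  open RingProperties (CommutativeRing.ring commutativeRing)
  open SemiringSum semiring
  open SetoidReasoning setoid
  open LinearMatroids ℝ E v public

  private
    vector : ∀ {X} → C X → Vectors ℝ {E} Dep X
    vector CX = proj₁ (Equivalence.to (C⇔v _) CX)

    -- The combination of two dependencies that cancels `e`. Both nontrivial circuit axioms use it:
    -- minimality of `Y` forces z to vanish when the support of `X` lies in that of `Y`, and
    -- elimination takes a circuit conformal to z.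
    module Cancel {X Y : SignedSet E} (x : Vectors ℝ {E} Dep X) (y : Vectors ℝ {E} Dep Y)
                  (e : ∣ E ∣) (Xe≢nil : X e ≢ nil) where
      a b : ∣ E ∣ → Carrier
      a = proj₁ x
      b = proj₁ y

      depa : Dep a
      depa = proj₁ (proj₂ x)

      depb : Dep b
      depb = proj₁ (proj₂ y)

      hasa : ∀ f → HasSign ℝ (a f) (X f)
      hasa = proj₂ (proj₂ x)

      hasb : ∀ f → HasSign ℝ (b f) (Y f)
      hasb = proj₂ (proj₂ y)

      ae≉0 : a e ≉ 0#
      ae≉0 = HasSign-nonnil ℝ (hasa e) Xe≢nil

      c : Carrier
      c = - (b e * recip (a e))

      z : ∣ E ∣ → Carrier
      z f = b f + c * a f

      depz : Dep z
      depz = Dep-combine {b} {a} c depb depa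

      ze≈0 : z e ≈ 0#
      ze≈0 = recip-cancel′ (b e) ae≉0

      z-support : ∀ f → X f ≡ nil → Y f ≡ nil → z f ≈ 0#
      z-support f Xf Yf = begin
        b f + c * a f  ≈⟨ +-cong (≡.subst (HasSign ℝ (b f)) Yf (hasb f))
                                 (*-congˡ (≡.subst (HasSign ℝ (a f)) Xf (hasa f))) ⟩
        0# + c * 0#    ≈⟨ +-identityˡ _ ⟩
        c * 0#         ≈⟨ zeroʳ c ⟩
        0#             ∎

      proportional : (∀ f → z f ≈ 0#) → ∀ f → Y f ≡ opposite (sign ℝ c · X f)
      proportional z≈0 f = HasSign-unique ℝ _ _ (hasb f)
        (HasSign-cong ℝ (opposite (sign ℝ c · X f)) (sym (+-inverseˡ-unique (b f) (c * a f) (z≈0 f)))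
          (HasSign-neg ℝ (sign ℝ c · X f) (HasSign-* ℝ (sign ℝ c) (X f) (hasSign ℝ c) (hasa f))))

  isOrientedMatroid : IsOrientedMatroid {E} C
  isOrientedMatroid = record
    { respects     = λ {X} {Y} X≗Y CX → Equivalence.from (C⇔v Y)
                       (respects X≗Y (Equivalence.to (C⇔v X) CX))
    ; nonempty     = λ {X} CX → proj₁ (proj₂ (Equivalence.to (C⇔v X) CX))
    ; symmetric    = λ {X} CX → Equivalence.from (C⇔v _)
                       (symmetric (Equivalence.to (C⇔v X) CX))
    ; incomparable = λ {X} {Y} CX CY → incomparable
                       (Equivalence.to (C⇔v X) CX) (Equivalence.to (C⇔v Y) CY)
    ; elimination  = elimination
    }
    where
    respects : ∀ {X Y} → X ≗ Y → LinearMatroid ℝ {E} v X → LinearMatroid ℝ {E} v Y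
    respects X≗Y ((a , dep , has) , (e , Xe) , minimal) =
        (a , dep , λ f → ≡.subst (HasSign ℝ (a f)) (X≗Y f) (has f))
      , (e , λ Ye → Xe (≡.trans (X≗Y e) Ye))
      , λ W vec ne W⊑Y f Yf → minimal W vec ne
          (λ g Wg Xg → W⊑Y g Wg (≡.trans (≡.sym (X≗Y g)) Xg)) f
          (λ Xf → Yf (≡.trans (≡.sym (X≗Y f)) Xf))

    symmetric : ∀ {X} → LinearMatroid ℝ {E} v X → LinearMatroid ℝ {E} v (− X)
    symmetric {X} ((a , dep , has) , (e , Xe) , minimal) =
        ((λ f → - a f) , Dep-neg {a} dep , λ f → HasSign-neg ℝ (X f) (has f))
      , (e , Xe ∘ opposite-nil)
      , λ W vec ne W⊑ f Xf → minimal W vec ne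
          (λ g Wg Xg → W⊑ g Wg (≡.cong opposite Xg)) f
          (Xf ∘ ≡.cong opposite)

    incomparable : ∀ {X Y} → LinearMatroid ℝ {E} v X → LinearMatroid ℝ {E} v Y →
                   X ⊑ Y → X ≗ Y ⊎ X ≗ − Y
    incomparable {X} {Y} (vecX , (e , Xe) , _) (vecY , _ , minimal) X⊑Y =
      compare (search {E} λ f → [ inj₂ , inj₁ ]′ (≈0? ℝ (z f)))
      where
      open Cancel {X} {Y} vecX vecY e Xe

      z⊑Y : signs z ⊑ Y
      z⊑Y f zf Yf with X f ≟ₛ nil
      ... | yes Xf = zf (sign-unique ℝ nil (z-support f Xf Yf))
      ... | no Xf  = X⊑Y f Xf Yf

      compare : (∃[ f ] z f ≉ 0#) ⊎ (∀ f → z f ≈ 0#) → X ≗ Y ⊎ X ≗ − Y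
      compare (inj₁ (f , zf≉0)) = contradiction (sign-unique ℝ nil ze≈0)
        (minimal (signs z) (z , depz , λ g → hasSign ℝ (z g)) (f , ≉0⇒sign≢nil {z} zf≉0)
          z⊑Y e (X⊑Y e Xe))
      compare (inj₂ z≈0) with sign ℝ c | proportional z≈0
      ... | pos | eq = inj₂ λ f → ≡.trans (≡.sym (opposite-involutive (X f)))
                                          (≡.cong opposite (≡.sym (eq f)))
      ... | nil | eq = contradiction (eq e) (X⊑Y e Xe)
      ... | neg | eq = inj₁ λ f → ≡.sym (≡.trans (eq f) (opposite-involutive (X f)))

    elimination : ∀ {X Y} → C X → C Y → ¬ (X ≗ − Y) → ∀ e → X e ≡ pos → Y e ≡ neg →
                  ∃[ Z ] (C Z
                    × (∀ f → Z f ≡ pos → f ≢ e × (X f ≡ pos ⊎ Y f ≡ pos))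
                    × (∀ f → Z f ≡ neg → f ≢ e × (X f ≡ neg ⊎ Y f ≡ neg)))
    elimination {X} {Y} CX CY X≢-Y e Xe Ye =
      eliminated (search {E} λ f → [ inj₂ , inj₁ ]′ (≈0? ℝ (z f)))
      where
      open Cancel {X} {Y} (vector CX) (vector CY) e (λ eq → pos≢nil (≡.trans (≡.sym Xe) eq))

      hasX = proj₂ (proj₂ (vector CX))
      hasY = proj₂ (proj₂ (vector CY))

      -- `X e` and `Y e` have opposite signs, so the cancelling coefficient is positive, and every
      -- nonzero sign of z already occurs in `X` or `Y`.
      0<c : 0# < c
      0<c = HasSign-neg ℝ neg (HasSign-* ℝ neg pos
        (≡.subst (HasSign ℝ _) Ye (hasY e))
        (recip-positive (≡.subst (HasSign ℝ _) Xe (hasX e))))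

      eliminated : (∃[ f ] z f ≉ 0#) ⊎ (∀ f → z f ≈ 0#) → _
      eliminated (inj₂ z≈0) = contradiction (λ f → ≡.trans
        (≡.sym (opposite-involutive (X f)))
        (≡.cong opposite (≡.sym (≡.trans (proportional z≈0 f)
          (≡.cong (λ s → opposite (s · X f)) (sign-unique ℝ pos 0<c)))))) X≢-Y
      eliminated (inj₁ (f , zf≉0)) with conformalCircuit {z} depz zf≉0
      ... | Z , circ , _ , Z≼z =
        Z , Equivalence.from (C⇔v Z) circ , origin pos≢nil , origin neg≢nil
        where
        origin : ∀ {s} → s ≢ nil → ∀ f → Z f ≡ s → f ≢ e × (X f ≡ s ⊎ Y f ≡ s)
        origin {s} s≢nil f Zf≡s =
            (λ { ≡.refl → s≢nil (≡.trans (≡.sym zf≡s) (sign-unique ℝ nil ze≈0)) })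
          , [ inj₂ , inj₁ ]′ (HasSign-+-split (hasY f)
              (HasSign-* ℝ pos (X f) 0<c (hasX f))
              (≡.subst (HasSign ℝ (z f)) zf≡s (hasSign ℝ (z f))) s≢nil)
          where
          zf≡s : signs z f ≡ s
          zf≡s = ≡.trans (≡.sym (Z≼z f λ Zf → s≢nil (≡.trans (≡.sym Zf≡s) Zf))) Zf≡s

  -- Through an element with nonzero product there is a circuit conformal to `a`. It has products of
  -- both signs with `Z`, and by conformality they are products of `a` as well.
  covector-⊥ : ∀ {Z a} → Covector {E} C Z → Dep a → signs a ⊥ Z
  covector-⊥ {Z} {a} cov dep with search {E} (λ e → [ inj₂ , inj₁ ]′ (dec⇒⊎ (signs a e · Z e ≟ₛ nil)))
  ... | inj₂ orth = inj₁ orth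
  ... | inj₁ (e , ne) with conformalCircuit {a} dep
                             {e} (sign≢nil⇒≉0 {a} λ eq → ne (≡.cong (_· Z e) eq))
  ...   | X , circ , Xe , X≼a with cov X (Equivalence.from (C⇔v X) circ)
  ...     | inj₁ orth = contradiction
    (≡.trans (≡.cong (_· Z e) (≡.sym (X≼a e Xe))) (orth e)) ne
  ...     | inj₂ ((f , p) , (g , q)) = inj₂ ((f , lift f p pos≢nil) , (g , lift g q neg≢nil))
    where
    lift : ∀ {s} f → X f · Z f ≡ s → s ≢ nil → signs a f · Z f ≡ s
    lift f p s≢nil = ≡.trans (≡.cong (_· Z f) (≡.sym (X≼a f λ Xf →
      s≢nil (≡.trans (≡.sym p) (≡.cong (_· Z f) Xf))))) p

  -- A single surviving product cannot be balanced. This turns sign conditions into exact equations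
  -- and is the source of rigidity in the uniqueness proof.
  covector-single : ∀ {Z a e} → Covector {E} C Z → Dep a → Z e ≢ nil →
                    (∀ f → f ≢ e → a f ≈ 0# ⊎ Z f ≡ nil) → a e ≈ 0#
  covector-single {Z} {a} {e} cov dep Ze h = ≡.subst (HasSign ℝ (a e))
    (·-nil (signs a e) (Z e) (⊥-single {X = signs a} {Z} (covector-⊥ {Z} {a} cov dep) off) Ze)
    (hasSign ℝ (a e))
    where
    off : ∀ f → f ≢ e → signs a f · Z f ≡ nil
    off f f≢e with h f f≢e
    ... | inj₁ eq = ≡.cong (_· Z f) (sign-unique ℝ nil eq)
    ... | inj₂ eq = ≡.trans (≡.cong (signs a f ·_) eq) (·-zeroʳ (signs a f))

  covector-pair : ∀ {Z a e f} → Covector {E} C Z → Dep a →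
                  (∀ g → g ≢ e → g ≢ f → a g ≈ 0# ⊎ Z g ≡ nil) →
                  signs a e · Z e ≡ opposite (signs a f · Z f)
  covector-pair {Z} {a} cov dep h =
    ⊥-pair {X = signs a} {Z} (covector-⊥ {Z} {a} cov dep) off
    where
    off : ∀ g → g ≢ _ → g ≢ _ → signs a g · Z g ≡ nil
    off g g≢e g≢f with h g g≢e g≢f
    ... | inj₁ eq = ≡.cong (_· Z g) (sign-unique ℝ nil eq)
    ... | inj₂ eq = ≡.trans (≡.cong (signs a g ·_) eq) (·-zeroʳ (signs a g))

  -- The values on `E` of a linear functional, described without the ambient space: the functions
  -- that annihilate all linear dependencies.
  Functional : (∣ E ∣ → Carrier) → Set
  Functional φ = ∀ a → Dep a → ∑ ℝ E (λ e → a e * φ e) ≈ 0#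

  Functional-coordinate : ∀ j → Functional (λ e → v e j)
  Functional-coordinate j a dep = dep j

  Functional-+* : ∀ {φ ψ} → Functional φ → ∀ c → Functional ψ →
                  Functional (λ e → φ e + c * ψ e)
  Functional-+* {φ} {ψ} fφ c fψ a dep = begin
    ∑ ℝ E (λ e → a e * (φ e + c * ψ e)) ≈⟨ ∑-linearʳ a φ ψ c ⟩
    _ + c * _                           ≈⟨ +-cong (fφ a dep) (*-congˡ (fψ a dep)) ⟩
    0# + c * 0#                         ≈⟨ +-identityˡ _ ⟩
    c * 0#                              ≈⟨ zeroʳ c ⟩
    0#                                  ∎

  -- The products of the coefficients of a circuit with the values of φ sum to zero, so by
  -- `sum-sign` they are all zero or take both signs.
  functional⇒covector : ∀ {φ Z} → Functional φ → (∀ e → HasSign ℝ (φ e) (Z e)) →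
                        Covector {E} C Z
  functional⇒covector {φ} {Z} fφ has X CX with vector CX
  ... | a , dep , hasa = balanced
    (search {E} λ e → dec⇒⊎ (X e · Z e ≟ₛ pos))
    (search {E} λ e → dec⇒⊎ (X e · Z e ≟ₛ neg))
    where
    hasT : ∀ e → HasSign ℝ (a e * φ e) (X e · Z e)
    hasT e = HasSign-* ℝ (X e) (Z e) (hasa e) (has e)

    one-sided : ∀ t → t ≢ nil → (∀ e → X e · Z e ≢ nil → X e · Z e ≡ t) →
                ∀ e → X e · Z e ≡ nil
    one-sided t t≢nil h with sum-sign ℝ _ _ t (λ i → hasT _) (λ i → h _)
    ... | inj₁ orth = allFin {E} (λ e → X e · Z e ≡ nil) orth
    ... | inj₂ sgn  = contradiction (HasSign-0 ℝ sgn (fφ a dep)) t≢nil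

    balanced : (∃[ e ] X e · Z e ≡ pos) ⊎ (∀ e → X e · Z e ≢ pos) →
               (∃[ e ] X e · Z e ≡ neg) ⊎ (∀ e → X e · Z e ≢ neg) → X ⊥ Z
    balanced (inj₁ p) (inj₁ q) = inj₂ (p , q)
    balanced (inj₁ _) (inj₂ q) = inj₁ (one-sided pos pos≢nil λ e → sided (q e))
      where
      sided : ∀ {s} → s ≢ neg → s ≢ nil → s ≡ pos
      sided {pos} _ _ = ≡.refl
      sided {nil} _ h = contradiction ≡.refl h
      sided {neg} h _ = contradiction ≡.refl h
    balanced (inj₂ p) _ = inj₁ (one-sided neg neg≢nil λ e → sided (p e))
      where
      sided : ∀ {s} → s ≢ pos → s ≢ nil → s ≡ neg
      sided {neg} _ _ = ≡.refl
      sided {nil} _ h = contradiction ≡.refl h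
      sided {pos} h _ = contradiction ≡.refl h

  -- One equation per coordinate, so that the solutions of this system are the linear relations
  -- among the members of `b`.
  columns : ∀ {s} → (Fin s → ∣ E ∣) → Fin d → Vector Carrier s
  columns b j i = v (b i) j

  functional-family : ∀ {s φ} (b : Fin s → ∣ E ∣) c → Solution ℝ (columns b) c →
                      Functional φ → dot ℝ c (φ ∘ b) ≈ 0#
  functional-family {φ = φ} b c sol fφ =
    trans (sym (push-∑ b c φ)) (fφ (push b c) (Dep-push b c sol))

  independent⁺ : ∀ {s} {b : Fin s → ∣ E ∣} → Injective _≡_ _≡_ b → Trivial ℝ (columns b) →
                 Independent {E} C b
  independent⁺ {b = b} inj triv = inj , λ X CX image → dependent X CX image
    where
    dependent : ∀ X → C X → ¬ (∀ e → X e ≢ nil → ∃[ j ] b j ≡ e)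
    dependent X CX image with Equivalence.to (C⇔v X) CX
    ... | (a , dep , has) , (e , Xe) , _ with image e Xe
    ...   | j , ≡.refl = Xe (HasSign-0 ℝ (has _) (triv (a ∘ b)
      (λ i → trans (sym (∑-image inj a (λ e → v e i)
               (λ e ae≉0 → image e (HasSign-≉0 ℝ (has e) ae≉0)))) (dep i)) j))

  nontrivial⇒¬independent : ∀ {s} {b : Fin s → ∣ E ∣} → Nontrivial ℝ (columns b) →
                            ¬ Independent {E} C b
  nontrivial⇒¬independent {b = b} (c , sol , (j , cj≉0)) (inj , indep)
    with conformalCircuit {push b c} (Dep-push b c sol) {b j}
           (λ eq → cj≉0 (trans (sym (push-image inj c j)) eq))
  ... | X , circ , _ , X≼ = indep X (Equivalence.from (C⇔v X) circ) image
    where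
    image : ∀ e → X e ≢ nil → ∃[ i ] b i ≡ e
    image e Xe with inImage? b e
    ... | inj₁ hit  = hit
    ... | inj₂ miss = contradiction
      (≡.trans (X≼ e Xe) (sign-unique ℝ nil (push-outside b c miss))) Xe

  independent-size : ∀ {s} (b : Fin s → ∣ E ∣) → Independent {E} C b → s ≤ d
  independent-size b indep =
    ℕ.≮⇒≥ λ d<s → nontrivial⇒¬independent (underdetermined ℝ (columns b) d<s) indep

  -- Applying ψ to a linear relation among the members of `b` isolates the coefficient at `j`.
  dual⇒trivial : ∀ {s} (b : Fin s → ∣ E ∣) →
                 (∀ j → ∃[ ψ ] Functional ψ × ψ (b j) ≉ 0# × (∀ i → i ≢ j → ψ (b i) ≈ 0#)) →
                 Trivial ℝ (columns b)
  dual⇒trivial b dual c sol j with dual j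
  ... | ψ , fψ , ψj≉0 , ψi≈0 = x*y≈0⇒y≈0 ℝ ψj≉0 (begin
    ψ (b j) * c j    ≈⟨ *-comm _ _ ⟩
    c j * ψ (b j)    ≈⟨ sum-single ℝ (λ i → c i * ψ (b i)) j
                          (λ i i≢j → trans (*-congˡ (ψi≈0 i i≢j)) (zeroʳ (c i))) ⟨
    dot ℝ c (ψ ∘ b)  ≈⟨ functional-family {φ = ψ} b c sol fψ ⟩
    0#               ∎)

  -- The pushed dependency vanishes off the image of `b`, so orthogonality can be read on the
  -- indices. This serves explicit dependencies on few elements, such as `balance`.
  covector-⊥-family : ∀ {Z s} {b : Fin s → ∣ E ∣} {c S} → Covector {E} C Z →
                      Injective _≡_ _≡_ b → Solution ℝ (columns b) c →
                      (∀ j → HasSign ℝ (c j) (S j)) → S ⊥ (Z ∘ b)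
  covector-⊥-family {Z} {b = b} {c} {S} cov inj sol has =
    transfer (covector-⊥ {Z} {push b c} cov (Dep-push b c sol))
    where
    at : ∀ j → signs (push b c) (b j) ≡ S j
    at j = sign-unique ℝ (S j) (HasSign-cong ℝ (S j) (sym (push-image inj c j)) (has j))

    find : ∀ {s} e → signs (push b c) e · Z e ≡ s → s ≢ nil → ∃[ j ] S j · Z (b j) ≡ s
    find e p s≢nil with inImage? b e
    ... | inj₁ (j , ≡.refl) = j , ≡.trans (≡.cong (_· Z e) (≡.sym (at j))) p
    ... | inj₂ miss = contradiction (≡.trans (≡.sym p)
      (≡.cong (_· Z e) (sign-unique ℝ nil (push-outside b c miss)))) s≢nil

    transfer : signs (push b c) ⊥ Z → S ⊥ (Z ∘ b)
    transfer (inj₁ h) = inj₁ λ j → ≡.trans (≡.cong (_· Z (b j)) (≡.sym (at j))) (h (b j))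
    transfer (inj₂ ((f , p) , (g , q))) = inj₂ (find f p pos≢nil , find g q neg≢nil)

  solution-tail : ∀ {s} e (b : Fin s → ∣ E ∣) c → Solution ℝ (columns (e Vector.∷ b)) c →
                  c zero ≈ 0# → Solution ℝ (columns b) (c ∘ suc)
  solution-tail e b c sol c₀≈0 j = begin
    dot ℝ (c ∘ suc) (columns b j)                   ≈⟨ +-identityˡ _ ⟨
    0# + dot ℝ (c ∘ suc) (columns b j)              ≈⟨ +-congʳ (trans (*-congʳ c₀≈0) (zeroˡ _)) ⟨
    c zero * v e j + dot ℝ (c ∘ suc) (columns b j)  ≈⟨ sol j ⟩
    0#                                              ∎

  ∷-injective : ∀ {s e} {b : Fin s → ∣ E ∣} → Injective _≡_ _≡_ b → (∀ i → b i ≢ e) →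
                Injective _≡_ _≡_ (e Vector.∷ b)
  ∷-injective inj b≢e {zero}  {zero}  _  = ≡.refl
  ∷-injective inj b≢e {zero}  {suc i} eq = contradiction (≡.sym eq) (b≢e i)
  ∷-injective inj b≢e {suc i} {zero}  eq = contradiction eq (b≢e i)
  ∷-injective inj b≢e {suc i} {suc j} eq = ≡.cong suc (inj eq)

  module _ {r : ℕ} {b : Fin r → ∣ E ∣} (inj : Injective _≡_ _≡_ b) (triv : Trivial ℝ (columns b))
           (maximal : ∀ {s} (b′ : Fin s → ∣ E ∣) → Independent {E} C b′ → s ≤ r) where

    private
      IsCoordinates : ∣ E ∣ → Vector Carrier r → Set
      IsCoordinates e p = (∀ j → v e j ≈ dot ℝ p (columns b j))
                        × (∀ i → b i ≡ e → ∀ l → p l ≈ basis ℝ i l)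

      coordinates : ∀ e → ∃ (IsCoordinates e)
      coordinates e with inImage? b e
      ... | inj₁ (i , ≡.refl) = basis ℝ i
        , (λ j → sym (trans (sum-cong-≋ λ l → *-comm (basis ℝ i l) (v (b l) j))
                            (dot-basis ℝ (λ l → v (b l) j) i)))
        , λ i′ eq l → reflexive (≡.cong (λ i → basis ℝ i l) (≡.sym (inj eq)))
      ... | inj₂ miss with solve ℝ d (columns (e Vector.∷ b))
      -- Otherwise `e` and `b` would be r + 1 independent elements.
      ...   | inj₂ (_ , triv′) = contradiction
        (maximal _ (independent⁺ (∷-injective inj miss) triv′)) ℕ.1+n≰n
      ...   | inj₁ (c , sol , (j , cj≉0)) = p , spans , λ i eq → contradiction eq (miss i)
        where
        c₀≉0 : c zero ≉ 0#
        c₀≉0 c₀≈0 = cj≉0 (all-zero j)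
          where
          all-zero : ∀ j → c j ≈ 0#
          all-zero zero    = c₀≈0
          all-zero (suc j) = triv (c ∘ suc) (solution-tail e b c sol c₀≈0) j

        p : Vector Carrier r
        p i = - recip (c zero) * c (suc i)

        spans : ∀ j → v e j ≈ dot ℝ p (columns b j)
        spans j = begin
          v e j                                  ≈⟨ recip-cancel (v e j) c₀≉0 ⟨
          c zero * (v e j * recip (c zero))      ≈⟨ *-assoc _ _ _ ⟨
          c zero * v e j * recip (c zero)        ≈⟨ *-congʳ (+-inverseˡ-unique (c zero * v e j) S (sol j)) ⟩
          - S * recip (c zero)                   ≈⟨ *-comm _ _ ⟩
          recip (c zero) * - S                   ≈⟨ -‿distribʳ-* _ _ ⟨
          - (recip (c zero) * S)                 ≈⟨ -‿distribˡ-* _ _ ⟩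
          - recip (c zero) * S                   ≈⟨ *-distribˡ-sum (- recip (c zero)) (λ i → c (suc i) * v (b i) j) ⟩
          sum (λ i → - recip (c zero) * (c (suc i) * v (b i) j))
                                                 ≈⟨ sum-cong-≋ (λ i → sym (*-assoc (- recip (c zero)) (c (suc i)) (v (b i) j))) ⟩
          dot ℝ p (columns b j)                  ∎
          where S = dot ℝ (c ∘ suc) (columns b j)

      P : ∣ E ∣ → Vector Carrier r
      P e = proj₁ (coordinates e)

      ∑-coordinates : ∀ (a : ∣ E ∣ → Carrier) j → ∑ ℝ E (λ e → a e * v e j) ≈
                      dot ℝ (λ i → ∑ ℝ E (λ e → a e * P e i)) (columns b j)
      ∑-coordinates a j = begin
        ∑ ℝ E (λ e → a e * v e j)
          ≈⟨ ∑-cong (λ e → trans (*-congˡ {a e} (proj₁ (proj₂ (coordinates e)) j))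
               (trans (*-distribˡ-sum (a e) (λ i → P e i * v (b i) j))
                 (sum-cong-≋ λ i → sym (*-assoc (a e) (P e i) (v (b i) j))))) ⟩
        ∑ ℝ E (λ e → sum (λ i → a e * P e i * v (b i) j))
          ≈⟨ ∑-comm-sum (λ e i → a e * P e i * v (b i) j) ⟩
        sum (λ i → ∑ ℝ E (λ e → a e * P e i * v (b i) j))
          ≈⟨ sum-cong-≋ (λ i → sym (∑-distribʳ (v (b i) j) (λ e → a e * P e i))) ⟩
        dot ℝ (λ i → ∑ ℝ E (λ e → a e * P e i)) (columns b j) ∎

    -- A maximal independent family spans, so every vector has coordinates in it; as the family
    -- satisfies no relation, the coordinate vectors have the same dependencies as the vectors. This
    -- replaces the arbitrary dimension d by the rank.
    coordinatize : ∃[ P ] (∀ X → C X ⇔ LinearMatroid ℝ {E} {r} P X)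
                        × (∀ i l → P (b i) l ≈ basis ℝ i l)
    coordinatize = P
      , (λ X → Circuits-cong ℝ {E} (λ X → mk⇔
           (λ (a , dep , has) → a
             , triv (λ i → ∑ ℝ E (λ e → a e * P e i)) (λ j → trans (sym (∑-coordinates a j)) (dep j)) , has)
           (λ (a , dep , has) → a
             , (λ j → trans (∑-coordinates a j)
                 (sum-zero ℝ λ i → trans (*-congʳ (dep i)) (zeroˡ _))) , has)) X
           ⇔-∘ C⇔v X)
      , λ i → proj₂ (proj₂ (coordinates (b i))) i ≡.refl

-- Cocircuits from hyperplanes

module Hyperplanes (ℝ : RealNumbers) (E : FiniteSet) {n : ℕ}
                   (v : ∣ E ∣ → Vector (RealNumbers.Carrier ℝ) (suc n)) (C : SignedSets E)
                   (C⇔v : ∀ X → C X ⇔ LinearMatroid ℝ {E} v X) where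
  open RealNumbers ℝ hiding (zero; _≤_)
  open SemiringSum semiring
  open SetoidReasoning setoid
  open Realization ℝ E v C C⇔v public

  module Hyperplane
    {φ : ∣ E ∣ → Carrier} {Z : SignedSet E} {h : Fin n → ∣ E ∣}
    (functional : Functional φ) (hasZ : ∀ e → HasSign ℝ (φ e) (Z e))
    (h-injective : Injective _≡_ _≡_ h) (h-trivial : Trivial ℝ (columns h))
    (Zh≡nil : ∀ i → Z (h i) ≡ nil)
    where

    φh≈0 : ∀ i → φ (h i) ≈ 0#
    φh≈0 i = ≡.subst (HasSign ℝ _) (Zh≡nil i) (hasZ (h i))

    ≢h : ∀ {e} → Z e ≢ nil → ∀ i → h i ≢ e
    ≢h Ze i ≡.refl = Ze (Zh≡nil i)

    extended-trivial : ∀ {e} → Z e ≢ nil → Trivial ℝ (columns (e Vector.∷ h))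
    extended-trivial {e} Ze c sol =
      λ { zero → c₀≈0 ; (suc i) → h-trivial (c ∘ suc) (solution-tail e h c sol c₀≈0) i }
      where
      c₀≈0 : c zero ≈ 0#
      c₀≈0 = x*y≈0⇒y≈0 ℝ (HasSign-nonnil ℝ (hasZ e) Ze) (begin
        φ e * c zero                  ≈⟨ *-comm _ _ ⟩
        c zero * φ e                  ≈⟨ +-identityʳ _ ⟨
        c zero * φ e + 0#             ≈⟨ +-congˡ (sum-zero ℝ λ i → trans (*-congˡ (φh≈0 i)) (zeroʳ _)) ⟨
        dot ℝ c (φ ∘ (e Vector.∷ h))  ≈⟨ functional-family (e Vector.∷ h) c sol functional ⟩
        0#                            ∎)

    extended : ∀ {e} → Z e ≢ nil → Independent {E} C (e Vector.∷ h)
    extended {e} Ze = independent⁺ (∷-injective h-injective (≢h Ze)) (extended-trivial Ze)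

    hasRank : Nonempty Z → HasRank {E} C (suc n)
    hasRank (e , Ze) = (_ , extended Ze) , independent-size

    -- For e and f off the hyperplane, the n + 2 elements e, f, h are
    -- dependent, and such a dependency does not vanish at e.
    cocircuit : Nonempty Z → Cocircuit {E} C Z
    cocircuit ne = functional⇒covector functional hasZ , ne , minimal
      where
      minimal : ∀ W → Covector {E} C W → Nonempty W → W ⊑ Z → Z ⊑ W
      minimal W cov (e , We) W⊑Z f Zf Wf
        with underdetermined ℝ (columns (e Vector.∷ f Vector.∷ h)) (ℕ.n<1+n _)
      ... | c , sol , (j , cj≉0) = cj≉0 (all-zero j)
        where
        b = e Vector.∷ f Vector.∷ h

        e≢ : ∀ j → b (suc j) ≢ e
        e≢ zero ≡.refl = We Wf
        e≢ (suc i) = ≢h (W⊑Z e We) i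

        at-e : push b c e ≈ c zero
        at-e = trans (+-cong (if-≡ (c zero) ≡.refl) (sum-zero ℝ λ j → if-≢ (c (suc j)) (e≢ j)))
                     (+-identityʳ (c zero))

        elsewhere : ∀ g → g ≢ e → push b c g ≈ 0# ⊎ W g ≡ nil
        elsewhere g g≢e with inImage? b g
        ... | inj₂ miss                    = inj₁ (push-outside b c miss)
        ... | inj₁ (zero , eq)             = contradiction (≡.sym eq) g≢e
        ... | inj₁ (suc zero , ≡.refl)     = inj₂ Wf
        ... | inj₁ (suc (suc i) , ≡.refl)  with W (h i) ≟ₛ nil
        ...   | yes Wh = inj₂ Wh
        ...   | no Wh  = contradiction (Zh≡nil i) (W⊑Z (h i) Wh)

        c₀≈0 : c zero ≈ 0#
        c₀≈0 = trans (sym at-e)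
          (covector-single {W} {push b c} cov (Dep-push b c sol) We elsewhere)

        all-zero : ∀ j → c j ≈ 0#
        all-zero zero    = c₀≈0
        all-zero (suc j) = extended-trivial Zf (c ∘ suc) (solution-tail e (f Vector.∷ h) c sol c₀≈0) j

  -- A certificate of independence that mentions signs only. It reduces the independence needed for
  -- `𝐎` and for `𝐎̃` to reading the table `D₁`.
  Dual : ∀ {K : Set} {s} → (K → SignedSet E) → (Fin s → ∣ E ∣) → Set
  Dual D h = ∀ j → ∃[ k ] D k (h j) ≢ nil × (∀ i → i ≢ j → D k (h i) ≡ nil)

  module SignedFunctionals
    {K : Set} {D : K → SignedSet E} (φ : K → ∣ E ∣ → Carrier)
    (functional : ∀ k → Functional (φ k)) (hasSigns : ∀ k e → HasSign ℝ (φ k e) (D k e))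
    where

    dual-injective : ∀ {s} {h : Fin s → ∣ E ∣} → Dual D h → Injective _≡_ _≡_ h
    dual-injective dual {i} {j} eq with i ≟ j
    ... | yes i≡j = i≡j
    ... | no i≢j  with dual j
    ...   | k , hj , hi = contradiction (≡.trans (≡.cong (D k) (≡.sym eq)) (hi i i≢j)) hj

    dual-trivial : ∀ {s} {h : Fin s → ∣ E ∣} → Dual D h → Trivial ℝ (columns h)
    dual-trivial {h = h} dual = dual⇒trivial h λ j → case dual j of λ (k , hj , hi) →
        φ k , functional k , HasSign-nonnil ℝ (hasSigns k (h j)) hj
      , λ i i≢j → ≡.subst (HasSign ℝ _) (hi i i≢j) (hasSigns k (h i))

    module _ (k : K) (h : Fin n → ∣ E ∣) (dual : Dual D h) (zero-h : ∀ i → D k (h i) ≡ nil)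
             (nonempty : Nonempty (D k)) where
      private
        module H = Hyperplane {φ k} {D k} {h} (functional k) (hasSigns k)
                     (dual-injective dual) (dual-trivial dual) zero-h

      hyperplane⇒cocircuit : Cocircuit {E} C (D k)
      hyperplane⇒cocircuit = H.cocircuit nonempty

      hyperplane⇒rank : HasRank {E} C (suc n)
      hyperplane⇒rank = H.hasRank nonempty

-- The sign table `D₁` and independent elements in the zero sets of its rows and columns

does-refl : ∀ {n} (i : Fin n) → does (i ≟ i) ≡ true
does-refl i with i ≟ i
... | yes _ = ≡.refl
... | no ne = contradiction ≡.refl ne

does-≢ : ∀ {n} {i j : Fin n} → i ≢ j → does (i ≟ j) ≡ false
does-≢ {i = i} {j} i≢j with i ≟ j
... | yes eq = contradiction eq i≢j
... | no _   = ≡.refl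

module _ {n : ℕ} where

  D₁-𝐘₁ : ∀ (i : Fin n) → D₁ (𝐘 i) (inj₁ i) ≡ pos
  D₁-𝐘₁ i rewrite does-refl i = ≡.refl

  D₁-𝐘₂ : ∀ (i : Fin n) → D₁ (𝐘 i) (inj₂ i) ≡ neg
  D₁-𝐘₂ i rewrite does-refl i = ≡.refl

  D₁-𝐘₁-≢ : ∀ {i j : Fin n} → i ≢ j → D₁ (𝐘 j) (inj₁ i) ≡ nil
  D₁-𝐘₁-≢ i≢j rewrite does-≢ i≢j = ≡.refl

  D₁-𝐘₂-≢ : ∀ {i j : Fin n} → i ≢ j → D₁ (𝐘 j) (inj₂ i) ≡ nil
  D₁-𝐘₂-≢ i≢j rewrite does-≢ i≢j = ≡.refl

  D₁-nonempty : Fin n → ∀ k → Nonempty (D₁ {n} k)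
  D₁-nonempty _ (𝐘 i) = inj₁ i , λ eq → pos≢nil (≡.trans (≡.sym (D₁-𝐘₁ i)) eq)
  D₁-nonempty i (𝐗 A) with lookup A i in eq
  ... | true  = inj₂ i , λ h → pos≢nil (≡.trans (≡.sym (≡.cong (if_then pos else nil) eq)) h)
  ... | false = inj₁ i , λ h → pos≢nil (≡.trans (≡.sym (≡.cong (if_then nil else pos) eq)) h)

  lookup-⊤ : ∀ (i : Fin n) → lookup Subset.⊤ i ≡ true
  lookup-⊤ i = lookup-replicate i true

  lookup-⊥ : ∀ (i : Fin n) → lookup Subset.⊥ i ≡ false
  lookup-⊥ i = lookup-replicate i false

  subset-ext : ∀ {A B : Subset n} → (∀ i → lookup A i ≡ lookup B i) → A ≡ B
  subset-ext {A} {B} h = ≡.trans (≡.sym (tabulate∘lookup A))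
                         (≡.trans (tabulate-cong h) (tabulate∘lookup B))

  -- The zero set of X_{A′} is the vertex set of a facet of the cross-polytope, with one vertex from
  -- each antipodal pair; the Y_j are dual to these vertices.
  module Facet (A : Subset n) where
    vertex : Fin n → ∣ [ n ]⊎[ n ]′ ∣
    vertex i = if lookup A i then inj₁ i else inj₂ i

    vertex-zero : ∀ i → D₁ (𝐗 A) (vertex i) ≡ nil
    vertex-zero i with lookup A i in eq
    ... | true rewrite eq  = ≡.refl
    ... | false rewrite eq = ≡.refl

    vertex-dual : ∀ j → ∃[ k ] D₁ k (vertex j) ≢ nil × (∀ i → i ≢ j → D₁ k (vertex i) ≡ nil)
    vertex-dual j = 𝐘 j , at , off
      where
      at : D₁ (𝐘 j) (vertex j) ≢ nil
      at eq with lookup A j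
      ... | true  = pos≢nil (≡.trans (≡.sym (D₁-𝐘₁ j)) eq)
      ... | false = neg≢nil (≡.trans (≡.sym (D₁-𝐘₂ j)) eq)

      off : ∀ i → i ≢ j → D₁ (𝐘 j) (vertex i) ≡ nil
      off i i≢j with lookup A i
      ... | true  = D₁-𝐘₁-≢ i≢j
      ... | false = D₁-𝐘₂-≢ i≢j

  -- The hyperplane x_i = 0 contains only n - 1 of the points e_j, so the vacant place i is filled
  -- with -e_{j₀}. For this a second index must exist: with n = 1 the support of Y₁ properly
  -- contains that of X_∅.
  module Equator (i j₀ : Fin n) (j₀≢i : j₀ ≢ i) where
    vertex : Fin n → ∣ [ n ]⊎[ n ]′ ∣
    vertex j = if does (j ≟ i) then inj₂ j₀ else inj₁ j

    vertex-zero : ∀ j → D₁ (𝐘 i) (vertex j) ≡ nil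
    vertex-zero j with j ≟ i
    ... | yes _  = D₁-𝐘₂-≢ j₀≢i
    ... | no j≢i = D₁-𝐘₁-≢ j≢i

    vertex-dual : ∀ j → ∃[ k ] D₁ k (vertex j) ≢ nil × (∀ l → l ≢ j → D₁ k (vertex l) ≡ nil)
    vertex-dual j with j ≟ i | j ≟ j₀
    ... | yes ≡.refl | _ = 𝐗 Subset.⊤ , at , off
      where
      at : D₁ (𝐗 Subset.⊤) (inj₂ j₀) ≢ nil
      at rewrite lookup-⊤ j₀ = λ ()
      off : ∀ l → l ≢ i → D₁ (𝐗 Subset.⊤) (vertex l) ≡ nil
      off l l≢i rewrite does-≢ l≢i | lookup-⊤ l = ≡.refl
    ... | no j≢i | yes ≡.refl = 𝐗 A , at , off
      where
      -- The facet through -e_{j₀} and all e_l with l ≠ j₀: of the chosen points it misses only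
      -- e_{j₀}.
      A = tabulate (λ l → if does (l ≟ j₀) then false else true)
      lookup-A : ∀ l → lookup A l ≡ (if does (l ≟ j₀) then false else true)
      lookup-A = lookup∘tabulate _
      at : D₁ (𝐗 A) (inj₁ j₀) ≢ nil
      at rewrite lookup-A j₀ | does-refl j₀ = λ ()
      off : ∀ l → l ≢ j₀ → D₁ (𝐗 A) (vertex l) ≡ nil
      off l l≢j₀ with l ≟ i
      ... | yes _ rewrite lookup-A j₀ | does-refl j₀ = ≡.refl
      ... | no _  rewrite lookup-A l | does-≢ l≢j₀ = ≡.refl
    ... | no j≢i | no j≢j₀ = 𝐘 j , (λ eq → pos≢nil (≡.trans (≡.sym (D₁-𝐘₁ j)) eq)) , off
      where
      off : ∀ l → l ≢ j → D₁ (𝐘 j) (vertex l) ≡ nil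
      off l l≢j with l ≟ i
      ... | yes _ = D₁-𝐘₂-≢ (j≢j₀ ∘ ≡.sym)
      ... | no _  = D₁-𝐘₁-≢ l≢j

  -- For e = i and e = i′ these are X̃[i] and X̃[i′].
  D₁ᵀ : ∣ [ n ]⊎[ n ]′ ∣ → SignedSet (𝓓₁ n)
  D₁ᵀ e k = D₁ k e

  D₁ᵀ-nonempty : ∀ e → Nonempty (D₁ᵀ e)
  D₁ᵀ-nonempty (inj₁ i) = 𝐘 i , λ eq → pos≢nil (≡.trans (≡.sym (D₁-𝐘₁ i)) eq)
  D₁ᵀ-nonempty (inj₂ i) = 𝐘 i , λ eq → neg≢nil (≡.trans (≡.sym (D₁-𝐘₂ i)) eq)

  -- A hyperplane of the adjoint: the elements 𝐘 j with j ≠ i together with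
  -- one element 𝐗 A, where A = [n] for e = i and A = ∅ for e = i′.
  module Dictator (e : ∣ [ n ]⊎[ n ]′ ∣) where
    index : ∣ [ n ]⊎[ n ]′ ∣ → Fin n
    index (inj₁ i) = i
    index (inj₂ i) = i

    opposite-vertex : ∣ [ n ]⊎[ n ]′ ∣ → ∣ [ n ]⊎[ n ]′ ∣
    opposite-vertex (inj₁ i) = inj₂ i
    opposite-vertex (inj₂ i) = inj₁ i

    same-side : ∣ [ n ]⊎[ n ]′ ∣ → Fin n → ∣ [ n ]⊎[ n ]′ ∣
    same-side (inj₁ _) = inj₁
    same-side (inj₂ _) = inj₂

    cofacet : ∣ [ n ]⊎[ n ]′ ∣ → Subset n
    cofacet (inj₁ _) = Subset.⊤
    cofacet (inj₂ _) = Subset.⊥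

    element : Fin n → ∣ 𝓓₁ n ∣
    element j = if does (j ≟ index e) then 𝐗 (cofacet e) else 𝐘 j

    cofacet-nil : ∀ e j → D₁ (𝐗 (cofacet e)) (same-side e j) ≡ nil
    cofacet-nil (inj₁ _) j rewrite lookup-⊤ j = ≡.refl
    cofacet-nil (inj₂ _) j rewrite lookup-⊥ j = ≡.refl

    cofacet-pos : ∀ e → D₁ (𝐗 (cofacet e)) (opposite-vertex e) ≡ pos
    cofacet-pos (inj₁ i) rewrite lookup-⊤ i = ≡.refl
    cofacet-pos (inj₂ i) rewrite lookup-⊥ i = ≡.refl

    𝐘-nil : ∀ e {j} → j ≢ index e → D₁ (𝐘 j) e ≡ nil
    𝐘-nil (inj₁ i) j≢i = D₁-𝐘₁-≢ (j≢i ∘ ≡.sym)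
    𝐘-nil (inj₂ i) j≢i = D₁-𝐘₂-≢ (j≢i ∘ ≡.sym)

    𝐘-nil-opposite : ∀ e {j} → j ≢ index e → D₁ (𝐘 j) (opposite-vertex e) ≡ nil
    𝐘-nil-opposite (inj₁ i) = 𝐘-nil (inj₂ i)
    𝐘-nil-opposite (inj₂ i) = 𝐘-nil (inj₁ i)

    𝐘-nil-same : ∀ e {i j} → i ≢ j → D₁ (𝐘 i) (same-side e j) ≡ nil
    𝐘-nil-same (inj₁ _) i≢j = D₁-𝐘₁-≢ (i≢j ∘ ≡.sym)
    𝐘-nil-same (inj₂ _) i≢j = D₁-𝐘₂-≢ (i≢j ∘ ≡.sym)

    𝐘-nonnil : ∀ e j → D₁ (𝐘 j) (same-side e j) ≢ nil
    𝐘-nonnil (inj₁ _) j eq = pos≢nil (≡.trans (≡.sym (D₁-𝐘₁ j)) eq)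
    𝐘-nonnil (inj₂ _) j eq = neg≢nil (≡.trans (≡.sym (D₁-𝐘₂ j)) eq)

    same-side-index : ∀ e → same-side e (index e) ≡ e
    same-side-index (inj₁ _) = ≡.refl
    same-side-index (inj₂ _) = ≡.refl

    element-zero : ∀ j → D₁ᵀ e (element j) ≡ nil
    element-zero j with j ≟ index e
    ... | yes _  = ≡.subst (λ f → D₁ (𝐗 (cofacet e)) f ≡ nil) (same-side-index e) (cofacet-nil e (index e))
    ... | no j≢i = 𝐘-nil e j≢i

    element-dual : ∀ j → ∃[ f ] D₁ᵀ f (element j) ≢ nil × (∀ l → l ≢ j → D₁ᵀ f (element l) ≡ nil)
    element-dual j with j ≟ index e
    ... | yes ≡.refl = opposite-vertex e , (λ eq → pos≢nil (≡.trans (≡.sym (cofacet-pos e)) eq)) , off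
      where
      off : ∀ l → l ≢ j → D₁ᵀ (opposite-vertex e) (element l) ≡ nil
      off l l≢i rewrite does-≢ l≢i = 𝐘-nil-opposite e l≢i
    ... | no j≢i = same-side e j , 𝐘-nonnil e j , off
      where
      off : ∀ l → l ≢ j → D₁ᵀ (same-side e j) (element l) ≡ nil
      off l l≢j with l ≟ index e
      ... | yes _ = cofacet-nil e j
      ... | no _  = 𝐘-nil-same e l≢j

  private
    -- X_{B′} vanishes at one of i and i′, while Y_i vanishes at neither.
    𝐘⋢𝐗 : ∀ i B → ¬ (∀ e → D₁ (𝐗 B) e ≡ nil → D₁ (𝐘 i) e ≡ nil)
    𝐘⋢𝐗 i B h with lookup B i in eq
    ... | true  = pos≢nil (≡.trans (≡.sym (D₁-𝐘₁ i)) (h (inj₁ i) (≡.cong (if_then nil else pos) eq)))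
    ... | false = neg≢nil (≡.trans (≡.sym (D₁-𝐘₂ i)) (h (inj₂ i) (≡.cong (if_then pos else nil) eq)))

    𝐗-distinct : ∀ a b →
      (if a then nil else pos) ≡ (if b then nil else pos)
      ⊎ ((if a then nil else pos) ≡ opposite (if b then nil else pos)
         × (if a then pos else nil) ≡ opposite (if b then pos else nil)) → a ≡ b
    𝐗-distinct true  true  _ = ≡.refl
    𝐗-distinct false false _ = ≡.refl
    𝐗-distinct true  false (inj₁ ())
    𝐗-distinct true  false (inj₂ (() , _))
    𝐗-distinct false true  (inj₁ ())
    𝐗-distinct false true  (inj₂ (() , _))

  D₁-distinct : ∀ (k l : ∣ 𝓓₁ n ∣) → D₁ k ≗ D₁ l ⊎ D₁ k ≗ − (D₁ l) → k ≡ l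
  D₁-distinct (𝐘 i) (𝐘 j) eq with i ≟ j
  ... | yes ≡.refl = ≡.refl
  ... | no i≢j = contradiction (≡.trans (≡.sym (D₁-𝐘₁ i)) (absent eq)) pos≢nil
    where
    absent : D₁ (𝐘 i) ≗ D₁ (𝐘 j) ⊎ D₁ (𝐘 i) ≗ − (D₁ (𝐘 j)) → D₁ (𝐘 i) (inj₁ i) ≡ nil
    absent (inj₁ h) = ≡.trans (h (inj₁ i)) (D₁-𝐘₁-≢ i≢j)
    absent (inj₂ h) = ≡.trans (h (inj₁ i)) (≡.cong opposite (D₁-𝐘₁-≢ i≢j))
  D₁-distinct (𝐘 i) (𝐗 B) (inj₁ h) = contradiction (λ e eq → ≡.trans (h e) eq) (𝐘⋢𝐗 i B)
  D₁-distinct (𝐘 i) (𝐗 B) (inj₂ h) =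
    contradiction (λ e eq → ≡.trans (h e) (≡.cong opposite eq)) (𝐘⋢𝐗 i B)
  D₁-distinct (𝐗 A) (𝐘 j) (inj₁ h) =
    contradiction (λ e eq → ≡.trans (≡.sym (h e)) eq) (𝐘⋢𝐗 j A)
  D₁-distinct (𝐗 A) (𝐘 j) (inj₂ h) =
    contradiction (λ e eq → opposite-nil (≡.trans (≡.sym (h e)) eq)) (𝐘⋢𝐗 j A)
  D₁-distinct (𝐗 A) (𝐗 B) (inj₁ h) = ≡.cong inj₂ (subset-ext λ i →
    𝐗-distinct (lookup A i) (lookup B i) (inj₁ (h (inj₁ i))))
  D₁-distinct (𝐗 A) (𝐗 B) (inj₂ h) = ≡.cong inj₂ (subset-ext λ i →
    𝐗-distinct (lookup A i) (lookup B i) (inj₂ (h (inj₁ i) , h (inj₂ i))))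

-- Only meaningful when s and t are not opposite: the sign of those that are not nil.
merge : Sign → Sign → Sign
merge pos _ = pos
merge nil t = t
merge neg _ = neg

Opposed : Sign → Sign → Set
Opposed s t = s ≢ nil × t ≡ opposite s

opposed? : ∀ s t → Opposed s t ⊎ ¬ Opposed s t
opposed? s t with s ≟ₛ nil | t ≟ₛ opposite s
... | yes eq | _      = inj₂ λ (ne , _) → ne eq
... | no ne  | yes eq = inj₁ (ne , eq)
... | no ne  | no neq = inj₂ λ (_ , eq) → neq eq

merge-left : ∀ s t → s ≢ nil → s ≡ merge s t
merge-left pos t _ = ≡.refl
merge-left nil t h = contradiction ≡.refl h
merge-left neg t _ = ≡.refl

merge-right : ∀ s t → ¬ Opposed s t → t ≢ nil → t ≡ merge s t
merge-right nil t   _ _ = ≡.refl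
merge-right s   nil _ h = contradiction ≡.refl h
merge-right pos pos _ _ = ≡.refl
merge-right neg neg _ _ = ≡.refl
merge-right pos neg h _ = contradiction ((λ ()) , ≡.refl) h
merge-right neg pos h _ = contradiction ((λ ()) , ≡.refl) h

multiple : ∀ {E : Set} {Z D : E → Sign} s → s ≢ nil → Z ⊑ D →
           (∀ e → D e ≢ nil → Z e ≡ s · D e) → Z ≗ D ⊎ Z ≗ − D
multiple {E} {Z} {D} s s≢nil Z⊑D h = signed s s≢nil everywhere
  where
  everywhere : ∀ e → Z e ≡ s · D e
  everywhere e with D e ≟ₛ nil | Z e ≟ₛ nil
  ... | no De  | _      = h e De
  ... | yes De | no Ze  = contradiction De (Z⊑D e Ze)
  ... | yes De | yes Ze = ≡.trans Ze (≡.sym (≡.trans (≡.cong (s ·_) De) (·-zeroʳ s)))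

  signed : ∀ s → s ≢ nil → (∀ e → Z e ≡ s · D e) → Z ≗ D ⊎ Z ≗ − D
  signed pos _ eq = inj₁ eq
  signed nil h _  = contradiction ≡.refl h
  signed neg _ eq = inj₂ eq

-- The cross-polytope and all its cocircuits

module CrossPolytope (ℝ : RealNumbers) (n : ℕ) where
  open RealNumbers ℝ hiding (zero; _≤_)
  open RingProperties (CommutativeRing.ring commutativeRing)
  open SemiringSum semiring
  open SetoidReasoning setoid

  E : FiniteSet
  E = [ n ]⊎[ n ]′

  homogenized : ∣ E ∣ → Vector Carrier (suc n)
  homogenized e = 1# Vector.∷ crossPolytope ℝ e

  𝐎-realization : ∀ X → 𝐎 ℝ n X ⇔ LinearMatroid ℝ {E} homogenized X
  𝐎-realization = Circuits-cong ℝ {E} λ X → mk⇔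
    (λ (a , (dep , sum≈0) , has) → a
      , (λ { zero → trans (∑-cong λ e → *-identityʳ (a e)) sum≈0 ; (suc j) → dep j }) , has)
    (λ (a , dep , has) → a
      , ((λ j → dep (suc j)) , trans (∑-cong λ e → sym (*-identityʳ (a e))) (dep zero)) , has)
    where open Summation ℝ E

  open Hyperplanes ℝ E homogenized (𝐎 ℝ n) 𝐎-realization

  dot-functional : ∀ y → Functional (λ e → dot ℝ y (crossPolytope ℝ e))
  dot-functional y a dep = begin
    ∑ ℝ E (λ e → a e * sum (λ j → y j * crossPolytope ℝ e j))
      ≈⟨ ∑-cong (λ e → trans (*-distribˡ-sum (a e) (λ j → y j * crossPolytope ℝ e j))
                             (sum-cong-≋ λ j → x*yz≈y*xz ℝ (a e) (y j) (crossPolytope ℝ e j))) ⟩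
    ∑ ℝ E (λ e → sum (λ j → y j * (a e * crossPolytope ℝ e j)))
      ≈⟨ ∑-comm-sum (λ e j → y j * (a e * crossPolytope ℝ e j)) ⟩
    sum (λ j → ∑ ℝ E (λ e → y j * (a e * crossPolytope ℝ e j)))
      ≈⟨ sum-zero ℝ (λ j → trans (sym (∑-distribˡ (y j) (λ e → a e * crossPolytope ℝ e j)))
                           (trans (*-congˡ (dep (suc j))) (zeroʳ (y j)))) ⟩
    0# ∎

  -- The coordinate x_j, and the form 1 + ⟨v_A, x⟩ of a facet inequality, with values 0 and 2 on the
  -- vertices. The coefficient vectors are the canonical vectors (e_j, 0) and (v_A, 1).
  φ : ∣ 𝓓₁ n ∣ → ∣ E ∣ → Carrier
  φ (𝐘 j) e = crossPolytope ℝ e j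
  φ (𝐗 A) e = 1# + 1# * dot ℝ (cubeVertex ℝ A) (crossPolytope ℝ e)

  φ-functional : ∀ k → Functional (φ k)
  φ-functional (𝐘 j) = Functional-coordinate (suc j)
  φ-functional (𝐗 A) = Functional-+* {λ _ → 1#} {λ e → dot ℝ (cubeVertex ℝ A) (crossPolytope ℝ e)}
    (Functional-coordinate zero) 1# (dot-functional (cubeVertex ℝ A))

  φ-hasSigns : ∀ k e → HasSign ℝ (φ k e) (D₁ k e)
  φ-hasSigns (𝐘 j) (inj₁ i) with i ≟ j
  ... | yes _ = 0<1
  ... | no _  = refl
  φ-hasSigns (𝐘 j) (inj₂ i) with i ≟ j
  ... | yes _ = pos-neg ℝ 0<1
  ... | no _  = -0#≈0#
  φ-hasSigns (𝐗 A) (inj₁ i) = HasSign-cong ℝ (D₁ (𝐗 A) (inj₁ i))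
    (sym (+-congˡ (trans (*-identityˡ _) (dot-basis ℝ (cubeVertex ℝ A) i)))) value
    where
    value : HasSign ℝ (1# + cubeVertex ℝ A i) (D₁ (𝐗 A) (inj₁ i))
    value with lookup A i
    ... | true  = -‿inverseʳ 1#
    ... | false = 0<1+1 ℝ
  φ-hasSigns (𝐗 A) (inj₂ i) = HasSign-cong ℝ (D₁ (𝐗 A) (inj₂ i))
    (sym (+-congˡ (trans (*-identityˡ _)
      (trans (dot-negʳ ℝ (cubeVertex ℝ A) (basis ℝ i))
             (-‿cong (dot-basis ℝ (cubeVertex ℝ A) i)))))) value
    where
    value : HasSign ℝ (1# - cubeVertex ℝ A i) (D₁ (𝐗 A) (inj₂ i))
    value with lookup A i
    ... | true  = <.<-respʳ-≈ (+-congˡ (sym (-‿involutive 1#))) (0<1+1 ℝ)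
      where module < = IsStrictTotalOrder isStrictTotalOrder
    ... | false = -‿inverseʳ 1#

  open SignedFunctionals {∣ 𝓓₁ n ∣} {D₁} φ φ-functional φ-hasSigns

  square : Fin n → Fin n → Fin 4 → ∣ E ∣
  square i j = inj₁ i Vector.∷ inj₂ i Vector.∷ inj₁ j Vector.∷ inj₂ j Vector.∷ Vector.[]

  balance : Vector Carrier 4
  balance = 1# Vector.∷ 1# Vector.∷ - 1# Vector.∷ - 1# Vector.∷ Vector.[]

  balanceSign : Fin 4 → Sign
  balanceSign = pos Vector.∷ pos Vector.∷ neg Vector.∷ neg Vector.∷ Vector.[]

  balanceSigns : ∀ l → HasSign ℝ (balance l) (balanceSign l)
  balanceSigns zero                   = 0<1
  balanceSigns (suc zero)             = 0<1
  balanceSigns (suc (suc zero))       = pos-neg ℝ 0<1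
  balanceSigns (suc (suc (suc zero))) = pos-neg ℝ 0<1

  square-injective : ∀ {i j} → i ≢ j → Injective _≡_ _≡_ (square i j)
  square-injective i≢j {zero} {zero} _ = ≡.refl
  square-injective i≢j {zero} {suc (suc zero)} ≡.refl = contradiction ≡.refl i≢j
  square-injective i≢j {zero} {suc (suc (suc zero))} ()
  square-injective i≢j {suc zero} {suc zero} _ = ≡.refl
  square-injective i≢j {suc zero} {suc (suc (suc zero))} ≡.refl = contradiction ≡.refl i≢j
  square-injective i≢j {suc (suc zero)} {zero} ≡.refl = contradiction ≡.refl i≢j
  square-injective i≢j {suc (suc zero)} {suc (suc zero)} _ = ≡.refl
  square-injective i≢j {suc (suc zero)} {suc (suc (suc zero))} ()
  square-injective i≢j {suc (suc (suc zero))} {suc zero} ≡.refl = contradiction ≡.refl i≢j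
  square-injective i≢j {suc (suc (suc zero))} {suc (suc (suc zero))} _ = ≡.refl

  balance-dot : ∀ f → f zero + f (suc zero) ≈ f (suc (suc zero)) + f (suc (suc (suc zero))) →
                dot ℝ balance f ≈ 0#
  balance-dot f eq = begin
    1# * x + (1# * y + (- 1# * z + (- 1# * w + 0#)))
      ≈⟨ +-cong (*-identityˡ x) (+-cong (*-identityˡ y)
           (+-cong (-1*x≈-x z) (trans (+-identityʳ _) (-1*x≈-x w)))) ⟩
    x + (y + (- z + - w))  ≈⟨ +-assoc x y _ ⟨
    x + y + (- z + - w)    ≈⟨ +-cong eq (-‿+-comm z w) ⟩
    z + w - (z + w)        ≈⟨ -‿inverseʳ (z + w) ⟩
    0#                     ∎
    where
    x = f zero
    y = f (suc zero)
    z = f (suc (suc zero))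
    w = f (suc (suc (suc zero)))

  square-solution : ∀ i j → Solution ℝ (columns (square i j)) balance
  square-solution i j zero    = balance-dot (λ _ → 1#) refl
  square-solution i j (suc l) = balance-dot (λ p → crossPolytope ℝ (square i j p) l)
    (trans (-‿inverseʳ _) (sym (-‿inverseʳ _)))

  𝐎-isOrientedMatroid : IsOrientedMatroid {E} (𝐎 ℝ n)
  𝐎-isOrientedMatroid = isOrientedMatroid

  module _ (2≤n : 2 ≤ n) where
    first second : Fin n
    first  = Fin.fromℕ< (ℕ.≤-trans (ℕ.s≤s ℕ.z≤n) 2≤n)
    second = Fin.fromℕ< 2≤n

    another : ∀ (i : Fin n) → ∃[ j ] j ≢ i
    another i with first ≟ i
    ... | no ne = first , ne
    ... | yes ≡.refl = second , λ eq →
      case ≡.trans (≡.sym (Fin.toℕ-fromℕ< 2≤n))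
                   (≡.trans (≡.cong Fin.toℕ eq) (Fin.toℕ-fromℕ< _)) of λ ()

    D₁-cocircuit : ∀ k → Cocircuit {E} (𝐎 ℝ n) (D₁ k)
    D₁-cocircuit (𝐘 i) = case another i of λ (j , j≢i) →
      hyperplane⇒cocircuit (𝐘 i) (Equator.vertex i j j≢i) (Equator.vertex-dual i j j≢i)
        (Equator.vertex-zero i j j≢i) (D₁-nonempty first (𝐘 i))
    D₁-cocircuit (𝐗 A) =
      hyperplane⇒cocircuit (𝐗 A) (Facet.vertex A) (Facet.vertex-dual A)
        (Facet.vertex-zero A) (D₁-nonempty first (𝐗 A))

    𝐎-rank : HasRank {E} (𝐎 ℝ n) (suc n)
    𝐎-rank = hyperplane⇒rank (𝐗 Subset.⊥) (Facet.vertex Subset.⊥)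
      (Facet.vertex-dual Subset.⊥) (Facet.vertex-zero Subset.⊥) (D₁-nonempty first (𝐗 Subset.⊥))

    module _ {Z : SignedSet E} (cov : Covector {E} (𝐎 ℝ n) Z)
             (unopposed : ∀ i → ¬ Opposed (Z (inj₁ i)) (Z (inj₂ i))) where

      side : Fin n → Sign
      side i = merge (Z (inj₁ i)) (Z (inj₂ i))

      side-inj₁ : ∀ i → Z (inj₁ i) ≢ nil → Z (inj₁ i) ≡ side i
      side-inj₁ i = merge-left _ _

      side-inj₂ : ∀ i → Z (inj₂ i) ≢ nil → Z (inj₂ i) ≡ side i
      side-inj₂ i = merge-right _ _ (unopposed i)

      -- Orthogonality to the circuit of e_i + (−e_i) = e_j + (−e_j).
      side-constant : ∀ i j → side i ≡ side j
      side-constant i j with i ≟ j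
      ... | yes ≡.refl = ≡.refl
      ... | no i≢j = conclude (covector-⊥-family {Z} {b = square i j} {balance} {balanceSign} cov
                       (square-injective i≢j) (square-solution i j) balanceSigns)
        where
        which : ∀ l {s} → balanceSign l · Z (square i j l) ≡ s → s ≢ nil →
                s ≡ side i ⊎ s ≡ opposite (side j)
        which zero ≡.refl ne = inj₁ (side-inj₁ i ne)
        which (suc zero) ≡.refl ne = inj₁ (side-inj₂ i ne)
        which (suc (suc zero)) ≡.refl ne =
          inj₂ (≡.cong opposite (side-inj₁ j (ne ∘ ≡.cong opposite)))
        which (suc (suc (suc zero))) ≡.refl ne =
          inj₂ (≡.cong opposite (side-inj₂ j (ne ∘ ≡.cong opposite)))

        combine : ∀ {s t} → pos ≡ s ⊎ pos ≡ opposite t → neg ≡ s ⊎ neg ≡ opposite t → s ≡ t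
        combine {pos} {pos} _ _ = ≡.refl
        combine {nil} {nil} _ _ = ≡.refl
        combine {neg} {neg} _ _ = ≡.refl
        combine {pos} {nil} _ (inj₁ ())
        combine {pos} {nil} _ (inj₂ ())
        combine {pos} {neg} _ (inj₁ ())
        combine {pos} {neg} _ (inj₂ ())
        combine {nil} {pos} (inj₁ ()) _
        combine {nil} {pos} (inj₂ ()) _
        combine {nil} {neg} _ (inj₁ ())
        combine {nil} {neg} _ (inj₂ ())
        combine {neg} {pos} (inj₁ ()) _
        combine {neg} {pos} (inj₂ ()) _
        combine {neg} {nil} (inj₁ ()) _
        combine {neg} {nil} (inj₂ ()) _

        conclude : balanceSign ⊥ (Z ∘ square i j) → side i ≡ side j
        conclude (inj₁ h) = ≡.cong₂ merge
          (≡.trans (h zero) (≡.sym (opposite-nil (h (suc (suc zero))))))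
          (≡.trans (h (suc zero)) (≡.sym (opposite-nil (h (suc (suc (suc zero)))))))
        conclude (inj₂ ((f , p) , (g , q))) =
          combine (which f p pos≢nil) (which g q neg≢nil)

    -- If `Z` separates some i from i′, its support contains that of Y_i. Otherwise all its nonzero
    -- signs agree by `side-constant`, and its support contains that of some X_{A′}. In both cases
    -- minimality of `Z` leaves only a signed multiple.
    D₁-exhaustive : ∀ Z → Cocircuit {E} (𝐎 ℝ n) Z → ∃[ k ] (Z ≗ D₁ k ⊎ Z ≗ − (D₁ k))
    D₁-exhaustive Z (cov , ne , minimal)
      with searchFin (λ i → opposed? (Z (inj₁ i)) (Z (inj₂ i)))
    ... | inj₁ (i , Zi≢nil , Zi′≡) = 𝐘 i , multiple (Z (inj₁ i)) Zi≢nil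
      (minimal (D₁ (𝐘 i)) (proj₁ (D₁-cocircuit (𝐘 i))) (D₁-nonempty i (𝐘 i)) 𝐘⊑Z) 𝐘-multiple
      where
      ·-pos : ∀ s → s ≡ s · pos
      ·-pos pos = ≡.refl
      ·-pos nil = ≡.refl
      ·-pos neg = ≡.refl

      ·-neg : ∀ s → opposite s ≡ s · neg
      ·-neg pos = ≡.refl
      ·-neg nil = ≡.refl
      ·-neg neg = ≡.refl

      𝐘-multiple : ∀ e → D₁ (𝐘 i) e ≢ nil → Z e ≡ Z (inj₁ i) · D₁ (𝐘 i) e
      𝐘-multiple (inj₁ j) De with j ≟ i
      ... | yes ≡.refl = ·-pos (Z (inj₁ j))
      ... | no _ = contradiction ≡.refl De
      𝐘-multiple (inj₂ j) De with j ≟ i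
      ... | yes ≡.refl = ≡.trans Zi′≡ (·-neg (Z (inj₁ j)))
      ... | no _ = contradiction ≡.refl De

      𝐘⊑Z : D₁ (𝐘 i) ⊑ Z
      𝐘⊑Z (inj₁ j) De with j ≟ i
      ... | yes ≡.refl = Zi≢nil
      ... | no _ = contradiction ≡.refl De
      𝐘⊑Z (inj₂ j) De Zj with j ≟ i
      ... | yes ≡.refl = Zi≢nil (≡.trans (≡.sym (opposite-involutive (Z (inj₁ j))))
                           (≡.cong opposite (≡.trans (≡.sym Zi′≡) Zj)))
      ... | no _ = contradiction ≡.refl De
    ... | inj₂ unopposed = 𝐗 A , multiple s s≢nil Z⊑𝐗 λ e De → ≡.trans (Z≡s e (𝐗⊑Z e De)) (𝐗-multiple e De)
      where
      s = side cov unopposed first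

      side≡s : ∀ i → side cov unopposed i ≡ s
      side≡s i = side-constant cov unopposed i first

      Z≡s : ∀ e → Z e ≢ nil → Z e ≡ s
      Z≡s (inj₁ i) Ze = ≡.trans (side-inj₁ cov unopposed i Ze) (side≡s i)
      Z≡s (inj₂ i) Ze = ≡.trans (side-inj₂ cov unopposed i Ze) (side≡s i)

      s≢nil : s ≢ nil
      s≢nil s≡nil = case ne of λ (e , Ze) → Ze (≡.trans (Z≡s e Ze) s≡nil)

      -- X_{A′} picks i where `Z` is nonzero at i, and i′ elsewhere; there `Z` is nonzero at i′,
      -- since the common side is not nil.
      A = tabulate (λ i → does (Z (inj₁ i) ≟ₛ nil))

      lookup-A : ∀ i → lookup A i ≡ does (Z (inj₁ i) ≟ₛ nil)
      lookup-A = lookup∘tabulate _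

      𝐗⊑Z : D₁ (𝐗 A) ⊑ Z
      𝐗⊑Z (inj₁ i) De Ze rewrite lookup-A i | Ze =
        De ≡.refl
      𝐗⊑Z (inj₂ i) De Ze with Z (inj₁ i) in eq
      ... | pos = De (≡.cong (if_then pos else nil) (≡.trans (lookup-A i) (≡.cong (λ s → does (s ≟ₛ nil)) eq)))
      ... | neg = De (≡.cong (if_then pos else nil) (≡.trans (lookup-A i) (≡.cong (λ s → does (s ≟ₛ nil)) eq)))
      ... | nil = s≢nil (≡.trans (≡.sym (side≡s i)) (≡.cong₂ merge eq Ze))

      Z⊑𝐗 : Z ⊑ D₁ (𝐗 A)
      Z⊑𝐗 = minimal (D₁ (𝐗 A)) (proj₁ (D₁-cocircuit (𝐗 A))) (D₁-nonempty first (𝐗 A)) 𝐗⊑Z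

      𝐗-multiple : ∀ e → D₁ (𝐗 A) e ≢ nil → s ≡ s · D₁ (𝐗 A) e
      𝐗-multiple e De = ≡.trans (·-comm pos s) (≡.cong (s ·_) (≡.sym (𝐗-pos e De)))
        where
        𝐗-pos : ∀ e → D₁ (𝐗 A) e ≢ nil → D₁ (𝐗 A) e ≡ pos
        𝐗-pos (inj₁ i) De with lookup A i
        ... | true  = contradiction ≡.refl De
        ... | false = ≡.refl
        𝐗-pos (inj₂ i) De with lookup A i
        ... | true  = ≡.refl
        ... | false = contradiction ≡.refl De

    isCocircuitSystem : IsCocircuitSystem {E} {𝓓₁ n} (𝐎 ℝ n) D₁
    isCocircuitSystem = record
      { cocircuit  = D₁-cocircuit
      ; exhaustive = D₁-exhaustive
      ; distinct   = D₁-distinct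
      }

-- The canonical adjoint

module CanonicalAdjoint (ℝ : RealNumbers) (n : ℕ) where
  open RealNumbers ℝ hiding (zero; _≤_)
  open RingProperties (CommutativeRing.ring commutativeRing)

  K : FiniteSet
  K = 𝓓₁ n

  -- The canonical vectors with the last coordinate in front.
  canonical : ∣ K ∣ → Vector Carrier (suc n)
  canonical (𝐘 i) = 0# Vector.∷ basis ℝ i
  canonical (𝐗 A) = 1# Vector.∷ cubeVertex ℝ A

  private
    column⁺ : ∀ j → ∃[ j′ ] ∀ k → canonicalVector ℝ k j ≡ canonical k j′
    column⁺ j with Fin.splitAt n j in eq
    ... | inj₁ i = suc i , λ
      { (𝐘 l) → ≡.cong [ basis ℝ l , 0# Vector.∷ Vector.[] ]′ eq
      ; (𝐗 A) → ≡.cong [ cubeVertex ℝ A , 1# Vector.∷ Vector.[] ]′ eq }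
    ... | inj₂ zero = zero , λ
      { (𝐘 l) → ≡.cong [ basis ℝ l , 0# Vector.∷ Vector.[] ]′ eq
      ; (𝐗 A) → ≡.cong [ cubeVertex ℝ A , 1# Vector.∷ Vector.[] ]′ eq }

    column⁻ : ∀ j → ∃[ j′ ] ∀ k → canonical k j ≡ canonicalVector ℝ k j′
    column⁻ zero = n ↑ʳ zero , λ
      { (𝐘 i) → ≡.sym (Vector.lookup-++ʳ (basis ℝ i) _ zero)
      ; (𝐗 A) → ≡.sym (Vector.lookup-++ʳ (cubeVertex ℝ A) _ zero) }
    column⁻ (suc j) = j ↑ˡ 1 , λ
      { (𝐘 i) → ≡.sym (Vector.lookup-++ˡ (basis ℝ i) _ j)
      ; (𝐗 A) → ≡.sym (Vector.lookup-++ˡ (cubeVertex ℝ A) _ j) }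

    -- Being a dependency is a condition on each coordinate separately, so it suffices that every
    -- coordinate of `w` occurs among those of `v`.
    permute : ∀ {d d′} {v : ∣ K ∣ → Vector Carrier d} {w : ∣ K ∣ → Vector Carrier d′} →
              (∀ j → ∃[ j′ ] ∀ k → w k j ≡ v k j′) →
              ∀ {a} → LinearDependency ℝ {K} v a → LinearDependency ℝ {K} w a
    permute same {a} dep j = case same j of λ (j′ , eq) → trans
      (∑-cong λ k → *-congˡ {a k} (reflexive (eq k))) (dep j′)
      where open Summation ℝ K

  𝐎̃-realization : ∀ X → 𝐎̃ ℝ n X ⇔ LinearMatroid ℝ {K} canonical X
  𝐎̃-realization = Circuits-cong ℝ {K} λ X → mk⇔
    (λ (a , dep , has) → a , permute {v = canonicalVector ℝ} {canonical} column⁻ {a} dep , has)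
    (λ (a , dep , has) → a , permute {v = canonical} {canonicalVector ℝ} column⁺ {a} dep , has)

  open Hyperplanes ℝ K canonical (𝐎̃ ℝ n) 𝐎̃-realization

  -- The functionals t + x_i and t - x_i, where t is the coordinate in front. Their values are those
  -- of `CrossPolytope.φ` at e_i and -e_i, with point and functional exchanged.
  ψ : ∣ [ n ]⊎[ n ]′ ∣ → ∣ K ∣ → Carrier
  ψ (inj₁ i) k = canonical k zero + 1# * canonical k (suc i)
  ψ (inj₂ i) k = canonical k zero + - 1# * canonical k (suc i)

  ψ-functional : ∀ e → Functional (ψ e)
  ψ-functional (inj₁ i) = Functional-+* {λ k → canonical k zero} {λ k → canonical k (suc i)}
    (Functional-coordinate zero) 1# (Functional-coordinate (suc i))
  ψ-functional (inj₂ i) = Functional-+* {λ k → canonical k zero} {λ k → canonical k (suc i)}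
    (Functional-coordinate zero) (- 1#) (Functional-coordinate (suc i))

  ψ-hasSigns : ∀ e k → HasSign ℝ (ψ e k) (D₁ᵀ e k)
  ψ-hasSigns (inj₁ i) (𝐘 j) with i ≟ j
  ... | yes ≡.refl = HasSign-cong ℝ pos
    (sym (trans (+-identityˡ _) (trans (*-identityˡ _) (basis-at ℝ j)))) 0<1
  ... | no i≢j = trans (+-identityˡ _) (trans (*-identityˡ _) (basis-off ℝ (i≢j ∘ ≡.sym)))
  ψ-hasSigns (inj₂ i) (𝐘 j) with i ≟ j
  ... | yes ≡.refl = HasSign-cong ℝ neg
    (sym (trans (+-identityˡ _) (trans (-1*x≈-x _) (-‿cong (basis-at ℝ j))))) (pos-neg ℝ 0<1)
  ... | no i≢j = trans (+-identityˡ _)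
    (trans (*-congˡ (basis-off ℝ (i≢j ∘ ≡.sym))) (zeroʳ _))
  ψ-hasSigns (inj₁ i) (𝐗 A) with lookup A i
  ... | true  = trans (+-congˡ (*-identityˡ _)) (-‿inverseʳ 1#)
  ... | false = HasSign-cong ℝ pos (sym (+-congˡ (*-identityˡ 1#))) (0<1+1 ℝ)
  ψ-hasSigns (inj₂ i) (𝐗 A) with lookup A i
  ... | true  = HasSign-cong ℝ pos
    (sym (+-congˡ (trans (-1*x≈-x _) (-‿involutive 1#)))) (0<1+1 ℝ)
  ... | false = trans (+-congˡ (*-identityʳ _)) (-‿inverseʳ 1#)

  open SignedFunctionals {∣ [ n ]⊎[ n ]′ ∣} {D₁ᵀ} ψ ψ-functional ψ-hasSigns

  𝐎̃-isOrientedMatroid : IsOrientedMatroid {K} (𝐎̃ ℝ n)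
  𝐎̃-isOrientedMatroid = isOrientedMatroid

  𝐎̃-cocircuit : ∀ e → Cocircuit {K} (𝐎̃ ℝ n) (λ k → D₁ k e)
  𝐎̃-cocircuit e = hyperplane⇒cocircuit e (Dictator.element e) (Dictator.element-dual e)
                     (Dictator.element-zero e)
                     (D₁ᵀ-nonempty e)

  𝐎̃-rank : Fin n → HasRank {K} (𝐎̃ ℝ n) (suc n)
  𝐎̃-rank i = hyperplane⇒rank (inj₁ i) (Dictator.element (inj₁ i)) (Dictator.element-dual (inj₁ i))
                (Dictator.element-zero (inj₁ i)) (D₁ᵀ-nonempty (inj₁ i))

-- Uniqueness among realizable adjoints

module Uniqueness (ℝ : RealNumbers) (n : ℕ) (i₀ : Fin n) where
  open RealNumbers ℝ hiding (zero; _≤_)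
  open RingProperties (CommutativeRing.ring commutativeRing)
  open SemiringSum semiring
  open SetoidReasoning setoid
  open CanonicalAdjoint ℝ n using (K; canonical; 𝐎̃-realization)

  ∅ ⊤ : Subset n
  ∅ = Subset.⊥
  ⊤ = Subset.⊤

  frame : Fin (suc n) → ∣ K ∣
  frame zero    = 𝐗 ∅
  frame (suc i) = 𝐘 i

  frame-injective : Injective _≡_ _≡_ frame
  frame-injective {zero}  {zero}  _      = ≡.refl
  frame-injective {suc i} {suc j} ≡.refl = ≡.refl

  D₁ᵀ-∅ : ∀ i → D₁ᵀ (inj₂ i) (𝐗 ∅) ≡ nil
  D₁ᵀ-∅ i rewrite lookup-⊥ i = ≡.refl

  D₁ᵀ-∅-pos : ∀ i → D₁ᵀ (inj₁ i) (𝐗 ∅) ≡ pos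
  D₁ᵀ-∅-pos i rewrite lookup-⊥ i = ≡.refl

  module FrameIndependent
    {d : ℕ} (w : ∣ K ∣ → Vector Carrier d) (M : SignedSets K)
    (M⇔w : ∀ X → M X ⇔ LinearMatroid ℝ {K} w X)
    (covectors : ∀ e → Covector {K} M (D₁ᵀ e)) where
    open Realization ℝ K w M M⇔w

    -- On the frame X̃[i′] is nonzero only at Y_i, so the coefficient of Y_i in a relation vanishes.
    -- What remains is X_∅, at which X̃[i₀] is positive.
    frame-trivial : Trivial ℝ (columns frame)
    frame-trivial c sol = λ
      { zero    → trans (sym (push-image frame-injective c zero)) at-∅
      ; (suc i) → trans (sym (push-image frame-injective c (suc i))) (at-𝐘 i) }
      where
      a : ∣ K ∣ → Carrier
      a = push frame c

      dep : Dep a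
      dep = Dep-push frame c sol

      at-𝐘 : ∀ i → a (𝐘 i) ≈ 0#
      at-𝐘 i = covector-single {D₁ᵀ (inj₂ i)} {a} (covectors (inj₂ i)) dep
        (λ eq → neg≢nil (≡.trans (≡.sym (D₁-𝐘₂ i)) eq)) off
        where
        off : ∀ f → f ≢ 𝐘 i → a f ≈ 0# ⊎ D₁ᵀ (inj₂ i) f ≡ nil
        off (𝐘 j) j≢i = inj₂ (D₁-𝐘₂-≢ {i = i} {j} λ { ≡.refl → j≢i ≡.refl })
        off (𝐗 A) _ with inImage? frame (𝐗 A)
        ... | inj₁ (zero , ≡.refl) = inj₂ (D₁ᵀ-∅ i)
        ... | inj₂ miss = inj₁ (push-outside frame c miss)

      at-∅ : a (𝐗 ∅) ≈ 0#
      at-∅ = covector-single {D₁ᵀ (inj₁ i₀)} {a} (covectors (inj₁ i₀)) dep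
        (λ eq → pos≢nil (≡.trans (≡.sym (D₁ᵀ-∅-pos i₀)) eq)) off
        where
        off : ∀ f → f ≢ 𝐗 ∅ → a f ≈ 0# ⊎ D₁ᵀ (inj₁ i₀) f ≡ nil
        off (𝐘 j) _ = inj₁ (at-𝐘 j)
        off (𝐗 A) A≢∅ = inj₁ (push-outside frame c
          λ { zero eq → A≢∅ (≡.sym eq) ; (suc _) () })

  module Coordinates
    (P : ∣ K ∣ → Vector Carrier (suc n)) (M : SignedSets K)
    (M⇔P : ∀ X → M X ⇔ LinearMatroid ℝ {K} P X)
    (P-frame : ∀ i l → P (frame i) l ≈ basis ℝ i l)
    (covectors : ∀ e → Covector {K} M (D₁ᵀ e)) where
    open Realization ℝ K P M M⇔P
    private
      module < = IsStrictTotalOrder isStrictTotalOrder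

    -- The dependency that writes `𝐗 A` in the frame. For A = ∅ the two occurrences of `𝐗 ∅` cancel,
    -- whence the side conditions in the lemmas that evaluate it.
    expansion : Subset n → ∣ K ∣ → Carrier
    expansion A = push (𝐗 A Vector.∷ frame) (1# Vector.∷ (λ j → - P (𝐗 A) j))

    expansion-dep : ∀ A → Dep (expansion A)
    expansion-dep A = Dep-push (𝐗 A Vector.∷ frame) (1# Vector.∷ (λ j → - P (𝐗 A) j)) λ j → begin
      1# * P (𝐗 A) j + dot ℝ (λ i → - P (𝐗 A) i) (λ i → P (frame i) j)
        ≈⟨ +-cong (*-identityˡ _) (sum-cong-≋ λ i → *-congˡ { - P (𝐗 A) i} (trans (P-frame i j) (basis-sym i j))) ⟩
      P (𝐗 A) j + dot ℝ (λ i → - P (𝐗 A) i) (basis ℝ j)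
        ≈⟨ +-congˡ (dot-basis ℝ (λ i → - P (𝐗 A) i) j) ⟩
      P (𝐗 A) j - P (𝐗 A) j
        ≈⟨ -‿inverseʳ _ ⟩
      0# ∎
      where
      basis-sym : ∀ {m} (i j : Fin m) → basis ℝ i j ≈ basis ℝ j i
      basis-sym i j with i ≟ j
      ... | yes ≡.refl = sym (basis-at ℝ i)
      ... | no i≢j     = sym (basis-off ℝ (i≢j ∘ ≡.sym))

    expansion-frame : ∀ A j → 𝐗 A ≢ frame j → expansion A (frame j) ≈ - P (𝐗 A) j
    expansion-frame A j ne = trans
      (+-cong (if-≢ 1# ne) (push-image frame-injective (λ j → - P (𝐗 A) j) j)) (+-identityˡ _)

    expansion-self : ∀ A → A ≢ ∅ → expansion A (𝐗 A) ≈ 1#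
    expansion-self A A≢∅ = trans
      (+-cong (if-≡ {𝐗 A} 1# ≡.refl) (push-outside frame (λ j → - P (𝐗 A) j)
        λ { zero ≡.refl → A≢∅ ≡.refl ; (suc _) () }))
      (+-identityʳ 1#)

    expansion-other : ∀ A {B} → B ≢ A → B ≢ ∅ → expansion A (𝐗 B) ≈ 0#
    expansion-other A B≢A B≢∅ = push-outside (𝐗 A Vector.∷ frame) (1# Vector.∷ (λ j → - P (𝐗 A) j)) λ
      { zero ≡.refl → B≢A ≡.refl ; (suc zero) ≡.refl → B≢∅ ≡.refl ; (suc (suc _)) () }

    ∈⇒≢∅ : ∀ {A : Subset n} {i} → lookup A i ≡ true → A ≢ ∅
    ∈⇒≢∅ {i = i} i∈A ≡.refl = case ≡.trans (≡.sym i∈A) (lookup-⊥ i) of λ ()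

    separated : ∀ {A B : Subset n} {i} → lookup A i ≡ true → lookup B i ≡ false → B ≢ A
    separated i∈A i∉B ≡.refl = case ≡.trans (≡.sym i∈A) i∉B of λ ()

    D₁ᵀ-in : ∀ {A : Subset n} {i} → lookup A i ≡ true → D₁ᵀ (inj₂ i) (𝐗 A) ≡ pos
    D₁ᵀ-in eq rewrite eq = ≡.refl

    -- X̃[i′] vanishes at X_∅, at X_{A′} because i ∉ A, and at Y_j for j ≠ i, so the expansion can
    -- meet it only in Y_i.
    coordinate-out : ∀ {A i} → lookup A i ≡ false → P (𝐗 A) (suc i) ≈ 0#
    coordinate-out {A} {i} i∉A = -‿injective (trans
      (sym (expansion-frame A (suc i) λ ()))
      (trans (covector-single {D₁ᵀ (inj₂ i)} {expansion A} {𝐘 i} (covectors (inj₂ i)) (expansion-dep A)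
        (λ eq → neg≢nil (≡.trans (≡.sym (D₁-𝐘₂ i)) eq)) off)
        (sym -0#≈0#)))
      where
      off : ∀ f → f ≢ 𝐘 i → expansion A f ≈ 0# ⊎ D₁ᵀ (inj₂ i) f ≡ nil
      off (𝐘 j) j≢i = inj₂ (D₁-𝐘₂-≢ {i = i} {j} λ { ≡.refl → j≢i ≡.refl })
      off (𝐗 B) _ with lookup B i in eq
      ... | true  = inj₁ (expansion-other A (separated eq i∉A ∘ ≡.sym) (∈⇒≢∅ eq))
      ... | false = inj₂ ≡.refl

    private
      substitute : ∀ {s t t′ z z′ u u′} → s · z ≡ opposite (t · u) →
                   z ≡ z′ → t ≡ t′ → u ≡ u′ → s · z′ ≡ opposite (t′ · u′)
      substitute eq ≡.refl ≡.refl ≡.refl = eq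

    -- By orthogonality to X̃[i′].
    coordinate-in : ∀ {A i} → lookup A i ≡ true → P (𝐗 A) (suc i) < 0#
    coordinate-in {A} {i} i∈A = HasSign-cong ℝ neg (-‿involutive _)
      (pos-neg ℝ (HasSign-cong ℝ pos (expansion-frame A (suc i) λ ())
        (≡.subst (HasSign ℝ _) (positive (signs (expansion A) (𝐘 i)) pair)
          (hasSign ℝ (expansion A (𝐘 i))))))
      where
      off : ∀ g → g ≢ 𝐘 i → g ≢ 𝐗 A → expansion A g ≈ 0# ⊎ D₁ᵀ (inj₂ i) g ≡ nil
      off (𝐘 j) j≢i _ = inj₂ (D₁-𝐘₂-≢ {i = i} {j} λ { ≡.refl → j≢i ≡.refl })
      off (𝐗 B) _ B≢A with lookup B i in eq
      ... | true  = inj₁ (expansion-other A (λ { ≡.refl → B≢A ≡.refl }) (∈⇒≢∅ eq))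
      ... | false = inj₂ ≡.refl

      positive : ∀ s → s · neg ≡ neg → s ≡ pos
      positive pos _ = ≡.refl

      pair : signs (expansion A) (𝐘 i) · neg ≡ opposite (pos · pos)
      pair = substitute {signs (expansion A) (𝐘 i)}
        (covector-pair {D₁ᵀ (inj₂ i)} {expansion A} {𝐘 i} {𝐗 A} (covectors (inj₂ i)) (expansion-dep A) off)
        (D₁-𝐘₂ i) (sign-unique ℝ pos (HasSign-cong ℝ pos (sym (expansion-self A (∈⇒≢∅ i∈A))) 0<1))
        (D₁ᵀ-in {A} {i} i∈A)

    -- Within the expansion X̃[i] is nonzero only at X_∅ and Y_i, and positive at both. The
    -- coefficient of Y_i is positive by `coordinate-in`, so that of X_∅ is negative.
    scale-in : ∀ {A i} → lookup A i ≡ true → 0# < P (𝐗 A) zero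
    scale-in {A} {i} i∈A = HasSign-cong ℝ pos (-‿involutive _)
      (neg-pos ℝ (HasSign-cong ℝ neg (expansion-frame A zero λ { ≡.refl → ∈⇒≢∅ i∈A ≡.refl })
        (≡.subst (HasSign ℝ _) (negative (signs (expansion A) (𝐗 ∅)) pair)
          (hasSign ℝ (expansion A (𝐗 ∅))))))
      where
      off : ∀ g → g ≢ 𝐗 ∅ → g ≢ 𝐘 i → expansion A g ≈ 0# ⊎ D₁ᵀ (inj₁ i) g ≡ nil
      off (𝐘 j) _ j≢i = inj₂ (D₁-𝐘₁-≢ {i = i} {j} λ { ≡.refl → j≢i ≡.refl })
      off (𝐗 B) B≢∅ _ with lookup B i in eq
      ... | true  = inj₂ ≡.refl
      ... | false = inj₁ (expansion-other A (separated i∈A eq) (λ { ≡.refl → B≢∅ ≡.refl }))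

      negative : ∀ s → s · pos ≡ neg → s ≡ neg
      negative neg _ = ≡.refl

      pair : signs (expansion A) (𝐗 ∅) · pos ≡ opposite (pos · pos)
      pair = substitute {signs (expansion A) (𝐗 ∅)}
        (covector-pair {D₁ᵀ (inj₁ i)} {expansion A} {𝐗 ∅} {𝐘 i} (covectors (inj₁ i)) (expansion-dep A) off)
        (D₁ᵀ-∅-pos i) (sign-unique ℝ pos (HasSign-cong ℝ pos (sym (expansion-frame A (suc i) λ ()))
          (neg-pos ℝ (coordinate-in i∈A))))
        (D₁-𝐘₁ i)

    scale-∅ : P (𝐗 ∅) zero ≈ 1#
    scale-∅ = P-frame zero zero

    private
      true⊎false : ∀ b → b ≡ true ⊎ b ≡ false
      true⊎false true  = inj₁ ≡.refl
      true⊎false false = inj₂ ≡.refl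

    scale-positive : ∀ A → 0# < P (𝐗 A) zero
    scale-positive A with searchFin (λ i → true⊎false (lookup A i))
    ... | inj₁ (i , i∈A) = scale-in i∈A
    ... | inj₂ empty with subset-ext {A = A} {∅} (λ i → ≡.trans (empty i) (≡.sym (lookup-⊥ i)))
    ...   | ≡.refl = HasSign-cong ℝ pos (sym scale-∅) 0<1

    ratio : Subset n → Carrier
    ratio A = P (𝐗 A) zero * recip (P (𝐗 ⊤) zero)

    -- The expansions of 𝐗 A and 𝐗 [n], scaled to cancel 𝐗 ∅, are compared by
    -- means of X̃[i], which vanishes on 𝐗 A and on 𝐗 [n].
    coordinate-ratio : ∀ {A i} → lookup A i ≡ true →
                       P (𝐗 A) (suc i) ≈ ratio A * P (𝐗 ⊤) (suc i)
    coordinate-ratio {A} {i} i∈A = begin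
      P (𝐗 A) (suc i)                  ≈⟨ +-inverseˡ-unique _ _ (-‿injective (trans
                                            (sym (difference (suc i) (λ ()) (λ ()))) (trans at-𝐘 (sym -0#≈0#)))) ⟩
      - (- ratio A * P (𝐗 ⊤) (suc i))  ≈⟨ -‿cong (sym (-‿distribˡ-* _ _)) ⟩
      - - (ratio A * P (𝐗 ⊤) (suc i))  ≈⟨ -‿involutive _ ⟩
      ratio A * P (𝐗 ⊤) (suc i)        ∎
      where
      z : ∣ K ∣ → Carrier
      z k = expansion A k + - ratio A * expansion ⊤ k

      ⊤≢∅ : ⊤ ≢ ∅
      ⊤≢∅ = ∈⇒≢∅ (lookup-⊤ i)

      difference : ∀ j → 𝐗 A ≢ frame j → 𝐗 ⊤ ≢ frame j →
                   z (frame j) ≈ - (P (𝐗 A) j + - ratio A * P (𝐗 ⊤) j)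
      difference j A≢ ⊤≢ = begin
        z (frame j)
          ≈⟨ +-cong (expansion-frame A j A≢) (*-congˡ (expansion-frame ⊤ j ⊤≢)) ⟩
        - P (𝐗 A) j + - ratio A * - P (𝐗 ⊤) j
          ≈⟨ +-congˡ (sym (-‿distribʳ-* _ _)) ⟩
        - P (𝐗 A) j + - (- ratio A * P (𝐗 ⊤) j)
          ≈⟨ -‿+-comm _ _ ⟩
        - (P (𝐗 A) j + - ratio A * P (𝐗 ⊤) j) ∎

      at-∅ : z (𝐗 ∅) ≈ 0#
      at-∅ = trans (difference zero (λ { ≡.refl → ∈⇒≢∅ i∈A ≡.refl })
                                    (⊤≢∅ ∘ inj₂-injective))
        (trans (-‿cong (recip-cancel′ (P (𝐗 A) zero) (positive⇒≉0 (scale-in {⊤} (lookup-⊤ i))))) -0#≈0#)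

      off : ∀ f → f ≢ 𝐘 i → z f ≈ 0# ⊎ D₁ᵀ (inj₁ i) f ≡ nil
      off (𝐘 j) j≢i = inj₂ (D₁-𝐘₁-≢ {i = i} {j} λ { ≡.refl → j≢i ≡.refl })
      off (𝐗 B) _ with lookup B i in eq | inImage? frame (𝐗 B)
      ... | true  | _                     = inj₂ ≡.refl
      ... | false | inj₁ (zero , ≡.refl)  = inj₁ at-∅
      ... | false | inj₂ miss             = inj₁ (trans
        (+-cong (expansion-other A (separated i∈A eq) B≢∅)
                (trans (*-congˡ (expansion-other ⊤ (separated (lookup-⊤ i) eq) B≢∅)) (zeroʳ _)))
        (+-identityˡ 0#))
        where
        B≢∅ : B ≢ ∅
        B≢∅ ≡.refl = miss zero ≡.refl

      at-𝐘 : z (𝐘 i) ≈ 0#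
      at-𝐘 = covector-single {D₁ᵀ (inj₁ i)} {z} {𝐘 i} (covectors (inj₁ i))
        (Dep-combine {expansion A} {expansion ⊤} (- ratio A) (expansion-dep A) (expansion-dep ⊤))
        (λ eq → pos≢nil (≡.trans (≡.sym (D₁-𝐘₁ i)) eq)) off

    private
      2β : Carrier
      2β = P (𝐗 ⊤) zero + P (𝐗 ⊤) zero

    -- In the notation of the overview this is 2 / γᵢ, the factor that turns β_A - σᵢ β_A γᵢ into
    -- -β_A, which is β_A times the entry -1 of v_A at i ∈ A.
    σ : Fin n → Carrier
    σ i = 2β * recip (- P (𝐗 ⊤) (suc i))

    σ-positive : ∀ i → 0# < σ i
    σ-positive i = *-positive (HasSign-+ ℝ pos (scale-positive ⊤) (scale-positive ⊤))
      (recip-positive (neg-pos ℝ (coordinate-in (lookup-⊤ i))))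

    σ-coordinate : ∀ i → σ i * P (𝐗 ⊤) (suc i) ≈ - 2β
    σ-coordinate i = begin
      σ i * p           ≈⟨ -‿involutive _ ⟨
      - - (σ i * p)     ≈⟨ -‿cong (-‿distribʳ-* _ _) ⟩
      - (σ i * - p)     ≈⟨ -‿cong (*-comm _ _) ⟩
      - (- p * σ i)     ≈⟨ -‿cong (recip-cancel 2β (positive⇒≉0 (neg-pos ℝ (coordinate-in (lookup-⊤ i))))) ⟩
      - 2β              ∎
      where p = P (𝐗 ⊤) (suc i)

    rescaling : ∣ K ∣ → Carrier
    rescaling (𝐘 i) = σ i
    rescaling (𝐗 A) = P (𝐗 A) zero

    rescaling-positive : ∀ k → 0# < rescaling k
    rescaling-positive (𝐘 i) = σ-positive i
    rescaling-positive (𝐗 A) = scale-positive A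

    rescaled-zero : ∀ k → rescaling k * canonical k zero ≈ P k zero
    rescaled-zero (𝐘 i) = trans (zeroʳ (σ i)) (sym (P-frame (suc i) zero))
    rescaled-zero (𝐗 A) = *-identityʳ _

    -- Up to rescaling, the canonical coordinates arise from those of the frame by x₀ ↦ x₀ and xᵢ ↦
    -- x₀ + σᵢ xᵢ. The summand x₀ appears because X_∅ is a unit vector in the frame but (1, ..., 1)
    -- canonically.
    rescaled-suc : ∀ i k → rescaling k * canonical k (suc i) ≈ P k zero + σ i * P k (suc i)
    rescaled-suc i (𝐘 j) with i ≟ j
    ... | yes ≡.refl = sym (trans (+-congʳ (P-frame (suc j) zero)) (trans (+-identityˡ _)
                         (*-congˡ (P-frame (suc j) (suc j)))))
    ... | no i≢j = trans (trans (*-congˡ (basis-off ℝ {k = j} {i} (i≢j ∘ ≡.sym))) (zeroʳ _)) (sym (trans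
      (+-cong (P-frame (suc j) zero) (trans (*-congˡ (trans (P-frame (suc j) (suc i))
        (basis-off ℝ {k = j} {i} (i≢j ∘ ≡.sym)))) (zeroʳ _)))
      (+-identityˡ 0#)))
    rescaled-suc i (𝐗 A) with lookup A i in eq
    ... | false = trans (*-identityʳ _) (sym (trans
      (+-congˡ (trans (*-congˡ (coordinate-out eq)) (zeroʳ _))) (+-identityʳ _)))
    ... | true = sym (begin
      β + σ i * P (𝐗 A) (suc i)          ≈⟨ +-congˡ (*-congˡ (coordinate-ratio eq)) ⟩
      β + σ i * (ratio A * p)            ≈⟨ +-congˡ (x*yz≈y*xz ℝ (σ i) (ratio A) p) ⟩
      β + ratio A * (σ i * p)            ≈⟨ +-congˡ (*-congˡ (σ-coordinate i)) ⟩
      β + ratio A * - 2β                 ≈⟨ +-congˡ (-‿distribʳ-* _ _) ⟨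
      β - ratio A * 2β                   ≈⟨ +-congˡ (-‿cong (distribˡ _ _ _)) ⟩
      β - (ratio A * β⊤ + ratio A * β⊤)  ≈⟨ +-congˡ (-‿cong (+-cong ratio-β ratio-β)) ⟩
      β - (β + β)                        ≈⟨ +-congˡ (-‿+-comm β β) ⟨
      β + (- β - β)                      ≈⟨ +-assoc _ _ _ ⟨
      β - β - β                          ≈⟨ +-congʳ (-‿inverseʳ β) ⟩
      0# - β                             ≈⟨ +-identityˡ _ ⟩
      - β                                ≈⟨ -‿cong (*-identityʳ β) ⟨
      - (β * 1#)                         ≈⟨ -‿distribʳ-* β 1# ⟩
      β * - 1#                           ∎)
      where
      β  = P (𝐗 A) zero
      β⊤ = P (𝐗 ⊤) zero
      p  = P (𝐗 ⊤) (suc i)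

      ratio-β : ratio A * β⊤ ≈ β
      ratio-β = trans (*-comm _ _) (recip-cancel β (positive⇒≉0 (scale-positive ⊤)))

    canonical-functional : ∀ {a} → Dep a → ∀ j →
                           ∑ ℝ K (λ k → a k * (rescaling k * canonical k j)) ≈ 0#
    canonical-functional {a} dep zero =
      trans (∑-cong λ k → *-congˡ {a k} (rescaled-zero k)) (dep zero)
    canonical-functional {a} dep (suc i) =
      trans (∑-cong λ k → *-congˡ {a k} (rescaled-suc i k))
        (Functional-+* {λ k → P k zero} {λ k → P k (suc i)}
          (Functional-coordinate zero) (σ i) (Functional-coordinate (suc i)) a dep)

    -- The coordinate change is triangular with nonzero diagonal entries 1 and σᵢ, hence invertible.
    canonical-functional⁻ : ∀ {a} → (∀ j → ∑ ℝ K (λ k → a k * (rescaling k * canonical k j)) ≈ 0#) →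
                            Dep a
    canonical-functional⁻ {a} h zero =
      trans (∑-cong λ k → *-congˡ {a k} (sym (rescaled-zero k))) (h zero)
    canonical-functional⁻ {a} h (suc i) = x*y≈0⇒y≈0 ℝ (positive⇒≉0 (σ-positive i)) (begin
      σ i * ∑ ℝ K (λ k → a k * P k (suc i))
        ≈⟨ +-identityˡ _ ⟨
      0# + σ i * ∑ ℝ K (λ k → a k * P k (suc i))
        ≈⟨ +-congʳ (canonical-functional⁻ {a} h zero) ⟨
      ∑ ℝ K (λ k → a k * P k zero) + σ i * ∑ ℝ K (λ k → a k * P k (suc i))
        ≈⟨ ∑-linearʳ a (λ k → P k zero) (λ k → P k (suc i)) (σ i) ⟨
      ∑ ℝ K (λ k → a k * (P k zero + σ i * P k (suc i)))
        ≈⟨ ∑-cong (λ k → *-congˡ {a k} (sym (rescaled-suc i k))) ⟩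
      ∑ ℝ K (λ k → a k * (rescaling k * canonical k (suc i)))
        ≈⟨ h (suc i) ⟩
      0# ∎)

    -- Rescaling the vectors rescales the coefficients of dependencies inversely. All factors are
    -- positive, so signs survive and no element is reoriented.
    vectors⇔ : ∀ X → Vectors ℝ {K} (LinearDependency ℝ {K} canonical) X ⇔ Vectors ℝ {K} Dep X
    vectors⇔ X = mk⇔ unscale rescale
      where
      rescale : Vectors ℝ {K} Dep X → Vectors ℝ {K} (LinearDependency ℝ {K} canonical) X
      rescale (a , dep , has) =
          (λ k → a k * rescaling k)
        , (λ j → trans (∑-cong λ k → *-assoc (a k) (rescaling k) (canonical k j))
                       (canonical-functional {a} dep j))
        , λ k → HasSign-cong ℝ (X k) (*-comm _ _)
                  (HasSign-* ℝ pos (X k) (rescaling-positive k) (has k))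

      unscale : Vectors ℝ {K} (LinearDependency ℝ {K} canonical) X → Vectors ℝ {K} Dep X
      unscale (b , dep , has) =
          (λ k → recip (rescaling k) * b k)
        , canonical-functional⁻ {λ k → recip (rescaling k) * b k}
            (λ j → trans (∑-cong λ k → cancel k j) (dep j))
        , λ k → HasSign-* ℝ pos (X k) (recip-positive (rescaling-positive k)) (has k)
        where
        cancel : ∀ k j → recip (rescaling k) * b k * (rescaling k * canonical k j) ≈ b k * canonical k j
        cancel k j = begin
          recip r * b k * (r * canonical k j)  ≈⟨ *-assoc _ _ _ ⟨
          recip r * b k * r * canonical k j    ≈⟨ *-congʳ (*-comm _ r) ⟩
          r * (recip r * b k) * canonical k j  ≈⟨ *-congʳ (*-congˡ (*-comm _ _)) ⟩
          r * (b k * recip r) * canonical k j  ≈⟨ *-congʳ (recip-cancel (b k) (positive⇒≉0 (rescaling-positive k))) ⟩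
          b k * canonical k j                  ∎
          where r = rescaling k

    𝐎̃⇔M : ∀ X → 𝐎̃ ℝ n X ⇔ M X
    𝐎̃⇔M X = mk⇔ (Equivalence.from (M⇔P X) ∘ Equivalence.to c ∘ Equivalence.to (𝐎̃-realization X))
                 (Equivalence.from (𝐎̃-realization X) ∘ Equivalence.from c ∘ Equivalence.to (M⇔P X))
      where c = Circuits-cong ℝ {K} vectors⇔ X

  unique : ∀ (M : SignedSets K) → IsAdjoint {[ n ]⊎[ n ]′} {K} (𝐎 ℝ n) (suc n) D₁ M →
           Realizable ℝ {K} M → ∀ X → 𝐎̃ ℝ n X ⇔ M X
  unique M adjoint (d , w , M⇔w)
    -- The frame has n + 1 elements, as many as the rank of `M`, so it is a maximal independent
    -- family.
    with Realization.coordinatize ℝ K w M M⇔w frame-injective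
           (FrameIndependent.frame-trivial w M M⇔w λ e → proj₁ (IsAdjoint.cocircuit˜ adjoint e))
           (proj₂ (IsAdjoint.rank˜ adjoint))
  ... | P , M⇔P , P-frame = Coordinates.𝐎̃⇔M P M M⇔P P-frame
    λ e → proj₁ (IsAdjoint.cocircuit˜ adjoint e)

theorem2p1 : (ℝ : RealNumbers) (n : ℕ) → 2 ≤ n →
    IsAdjoint {[ n ]⊎[ n ]′} {𝓓₁ n} (𝐎 ℝ n) (suc n) D₁ (𝐎̃ ℝ n)
    × Realizable ℝ {𝓓₁ n} (𝐎̃ ℝ n)
    × (∀ (M : SignedSets (𝓓₁ n)) →
    IsAdjoint {[ n ]⊎[ n ]′} {𝓓₁ n} (𝐎 ℝ n) (suc n) D₁ M →
    Realizable ℝ {𝓓₁ n} M →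
    _≅_ {𝓓₁ n} {𝓓₁ n} M (𝐎̃ ℝ n))
theorem2p1 ℝ n 2≤n =
    record
      { isOrientedMatroid  = O.𝐎-isOrientedMatroid
      ; rank               = O.𝐎-rank 2≤n
      ; isCocircuitSystem  = O.isCocircuitSystem 2≤n
      ; isOrientedMatroid˜ = O˜.𝐎̃-isOrientedMatroid
      ; rank˜              = O˜.𝐎̃-rank (O.first 2≤n)
      ; cocircuit˜         = O˜.𝐎̃-cocircuit
      }
  , (_ , canonicalVector ℝ , λ _ → ⇔-id _)
  , λ M adjoint realizable →
      -- The elements keep their names: the two sets of circuits are equal, so the identity is an
      -- isomorphism.
      ↔-id _ , Uniqueness.unique ℝ n (O.first 2≤n) M adjoint realizable
  where
  module O  = CrossPolytope ℝ n
  module O˜ = CanonicalAdjoint ℝ n
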